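{- If $T\ne K_1$ is a tree and if $\mathcal{F}$ is a family of graphs, then for every integer $k\ge 1$ either $$\mathrm{ex}(n,T,\mathcal{F})=\Omega_{T,k}(n^k),$$ or $$\mathrm{ex}(n,T,\mathcal{F})=O_{T,k,\mathcal{F}}\left(\mathrm{ex}(n,\mathcal{F})^{k-1}\right).$$
   Context: Graphs are finite and simple. A graph is $\mathcal{F}$-free, for a family of graphs $\mathcal{F}$, if it contains no (not necessarily induced) subgraph isomorphic to a member of $\mathcal{F}$. $\mathrm{ex}(n,\mathcal{F})$ is the maximum number of edges in an $n$-vertex $\mathcal{F}$-free graph, and $\mathrm{ex}(n,T,\mathcal{F})$ is the maximum number of copies of $T$ (subgraphs isomorphic to $T$) that an $n$-vertex $\mathcal{F}$-free graph can have; both are $0$ by convention if there is no $\mathcal{F}$-free graph on $n$ vertices. Asymptotics are as $n\to\infty$, and subscripts on $O,\Omega$ indicate what the implied constants may depend on. -}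

module Defs where

open import Axiom.ExcludedMiddle using (ExcludedMiddle)
open import Data.Bool.Base using (Bool; true; false)
import Data.Bool.Properties as Bool
open import Data.Fin.Base using (Fin; zero; suc; inject₁; fromℕ)
open import Data.Fin.Properties using (all?; _<?_)
open import Data.Fin.Subset using (Subset; _∈_)
open import Data.List.Base
  using (List; []; _∷_; length; map; mapMaybe; filter; allFin;
         cartesianProduct; cartesianProductWith)
open import Data.List.Extrema.Nat using (max)
open import Data.Maybe.Base using (Maybe; just; nothing)
open import Data.Nat.Base using (ℕ; zero; suc; _+_; _*_; _≤_; NonZero)
open import Data.Product.Base using (Σ; ∃; ∃-syntax; _×_; _,_)
open import Data.Vec.Base using (Vec; []; _∷_; lookup)
open import Function.Bundles using (_↔_; _⇔_; module Inverse)
open import Function.Definitions using (Injective)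
open import Level using (0ℓ)
open import Relation.Binary.Construct.Closure.ReflexiveTransitive using (Star)
open import Relation.Binary.PropositionalEquality using (_≡_; refl)
open import Relation.Nullary using (¬_; yes; no)
open import Relation.Nullary.Decidable using (_×-dec_)
open import Relation.Unary using (Pred)

record Graph (n : ℕ) : Set where
  field
    adj        : Fin n → Fin n → Bool
    adj-sym    : ∀ x y → adj x y ≡ adj y x
    adj-irrefl : ∀ x → adj x x ≡ false

open Graph public

Adj : ∀ {n} → Graph n → Fin n → Fin n → Set
Adj G x y = adj G x y ≡ true

K₁ : Graph 1
K₁ = record
  { adj        = λ _ _ → false
  ; adj-sym    = λ _ _ → refl
  ; adj-irrefl = λ _ → refl
  }

_≅_ : ∀ {m n} → Graph m → Graph n → Set
_≅_ {m} {n} G H =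
  Σ (Fin m ↔ Fin n) λ φ →
    ∀ x y → adj G x y ≡ adj H (Inverse.to φ x) (Inverse.to φ y)

Connected : ∀ {n} → Graph n → Set
Connected {n} G = NonZero n × (∀ x y → Star (Adj G) x y)

-- A cycle of length 3 + m: distinct vertices c 0, …, c (2 + m), consecutive
-- ones adjacent, and the last adjacent to the first.
Cycle : ∀ {n} → Graph n → Set
Cycle {n} G =
  ∃[ m ] Σ (Fin (3 + m) → Fin n) λ c →
    Injective _≡_ _≡_ c
    × (∀ (i : Fin (2 + m)) → Adj G (c (inject₁ i)) (c (suc i)))
    × Adj G (c (fromℕ (2 + m))) (c zero)

IsTree : ∀ {n} → Graph n → Set
IsTree G = Connected G × ¬ Cycle G

-- A candidate subgraph of a graph on Fin n is a vertex set together with an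
-- edge set, the latter stored as a graph on all of Fin n.  Vertices outside
-- the vertex set are not part of the subgraph.
Candidate : ℕ → Set
Candidate n = Subset n × Graph n

_IsSubgraphOf_ : ∀ {n} → Candidate n → Graph n → Set
(S , E) IsSubgraphOf G = ∀ x y → Adj E x y → x ∈ S × y ∈ S × Adj G x y

-- H is isomorphic to the graph with vertex set S and edge set E: an
-- isomorphism is an injection into Fin n with image S carrying adjacency in H
-- to adjacency in E.
_IsoToSub_ : ∀ {h n} → Graph h → Candidate n → Set
_IsoToSub_ {h} {n} H (S , E) =
  Σ (Fin h → Fin n) λ f →
    Injective _≡_ _≡_ f
    × (∀ x → x ∈ S ⇔ (∃[ u ] f u ≡ x))
    × (∀ u v → adj H u v ≡ adj E (f u) (f v))

IsCopy : ∀ {h n} → Graph h → Graph n → Candidate n → Set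
IsCopy H G C = C IsSubgraphOf G × H IsoToSub C

Family : Set₁
Family = Pred (∃ Graph) 0ℓ

Free : ∀ {n} → Family → Graph n → Set
Free F G = ∀ h (H : Graph h) → F (h , H) → ¬ ∃ (IsCopy H G)

vecs : ∀ {A : Set} → List A → ∀ n → List (Vec A n)
vecs xs zero    = [] ∷ []
vecs xs (suc n) = cartesianProductWith _∷_ xs (vecs xs n)

subsets : ∀ n → List (Subset n)
subsets = vecs (false ∷ true ∷ [])

fromMatrix : ∀ {n} → Vec (Subset n) n → Maybe (Graph n)
fromMatrix M
  with all? (λ x → all? λ y → lookup (lookup M x) y Bool.≟ lookup (lookup M y) x)
     | all? (λ x → lookup (lookup M x) x Bool.≟ false)
... | yes s | yes i = just (record { adj        = λ x y → lookup (lookup M x) y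
                                   ; adj-sym    = s
                                   ; adj-irrefl = i })
... | _     | _     = nothing

-- Every graph on Fin n, each exactly once up to pointwise equality of adj.
graphs : ∀ n → List (Graph n)
graphs n = mapMaybe fromMatrix (vecs (subsets n) n)

edgeCount : ∀ {n} → Graph n → ℕ
edgeCount {n} G =
  length (filter (λ (x , y) → (x <? y) ×-dec (adj G x y Bool.≟ true))
                 (cartesianProduct (allFin n) (allFin n)))

-- Excluded middle decides the predicates being filtered by; F-freeness has no
-- decision procedure for an arbitrary family F.
copyCount : ExcludedMiddle 0ℓ → ∀ {t n} → Graph t → Graph n → ℕ
copyCount em {n = n} T G =
  length (filter (λ C → em {IsCopy T G C})
                 (cartesianProduct (subsets n) (graphs n)))

-- The value is 0 if there is no F-free graph on n vertices.
maxOverFree : ExcludedMiddle 0ℓ → Family → ∀ n → (Graph n → ℕ) → ℕ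
maxOverFree em F n φ =
  max 0 (map φ (filter (λ G → em {Free F G}) (graphs n)))

ex : ExcludedMiddle 0ℓ → ℕ → Family → ℕ
ex em n F = maxOverFree em F n edgeCount

exCopies : ExcludedMiddle 0ℓ → ∀ {t} → ℕ → Graph t → Family → ℕ
exCopies em n T F = maxOverFree em F n (copyCount em T)

-- f n ≤ C · g n for all n ≥ N.  Then f = O(g) with implied constant C, and
-- g = Ω(f) with implied constant 1 / C (for C > 0).
Bounded : (C N : ℕ) (f g : ℕ → ℕ) → Set
Bounded C N f g = ∀ n → N ≤ n → f n ≤ C * g n

-- List the vertices of T so that each but the first has exactly one earlier
-- neighbour, its parent.  For a set U of vertices write c(U) for the number of
-- components of T outside U, and call s embeddings of T into G a sunflower with
-- kernel U if they agree on U and are otherwise disjoint.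
--
-- If some U with c(U) ≥ k has, for every n, a sunflower of n / t petals in an
-- F-free graph on n vertices, then choosing a petal for each component separately
-- gives at least (n / t) ^ k copies of T.
--
-- Otherwise there is an S such that, in F-free graphs G on n ≥ S vertices, no U
-- with c(U) ≥ k is the kernel of a sunflower of S petals.  The delta-system method
-- reduces counting the embeddings to homogeneous families, in which every set of
-- agreement of two embeddings is the kernel of a sunflower through each member.
-- Such kernels are closed under intersection.  Hence fewer than k edges of T meet
-- the complements of all of them, for otherwise some intersection of kernels would
-- leave k components; an embedding in the family is determined by its values on
-- these edges.

module Submission where

open import Defs
open import Axiom.ExcludedMiddle using (ExcludedMiddle)
open import Data.Bool.Base using (Bool; true; false; if_then_else_)
import Data.Bool.Properties as Bool
open import Data.Fin.Base using (Fin; zero; suc; toℕ; inject₁; inject≤; fromℕ; fromℕ<)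
import Data.Fin.Base as Fin using (_<_)
import Data.Fin.Properties as Fin
open import Data.Fin.Subset using (Subset; _∈_; _∉_; _∩_; ⊤)
open import Data.Fin.Subset.Properties
  using (_∈?_; ∈⊤; x∈p∩q⁺; x∈p∩q⁻; ∩-identityˡ; ⊆-antisym)
open import Data.List.Base
  using (List; []; _∷_; _++_; length; lookup; map; mapMaybe; filter; tabulate; allFin;
         cartesianProduct; cartesianProductWith)
open import Data.List.Extrema.Nat using (max; v≤max⁺; max≤v⁺)
open import Data.List.Membership.Propositional using () renaming (_∈_ to _∈ˡ_; _∉_ to _∉ˡ_)
open import Data.List.Membership.Propositional.Properties
open import Data.List.Properties using (length-tabulate; length-map; length-++; filter-notAll)
open import Data.List.Relation.Unary.All as All using (All; []; _∷_)
open import Data.List.Relation.Unary.AllPairs as AllPairs using (AllPairs; []; _∷_)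
import Data.List.Relation.Unary.AllPairs.Properties as AllPairs
open import Data.List.Relation.Unary.Any as Any using (here; there)
open import Data.List.Relation.Unary.Any.Properties using (lookup-index)
open import Data.List.Relation.Unary.Unique.Propositional using (Unique)
import Data.List.Relation.Unary.Unique.Propositional.Properties as Unique
import Data.List.Relation.Unary.Unique.Setoid.Properties as SetoidUnique
open import Data.Maybe.Base using (Maybe; just; nothing)
open import Data.Nat.Base
open import Data.Nat.DivMod using (m/n*n≤m; m≡m%n+[m/n]*n; m%n<n; m/n≤m; m≥n⇒m/n>0)
open import Data.Nat.ListAction using (sum)
open import Data.Nat.Properties hiding (_≟_)
open import Data.Product.Base using (Σ; ∃-syntax; _×_; _,_; proj₁; proj₂)
open import Data.Sum.Base using (_⊎_; inj₁; inj₂; [_,_]′)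
open import Data.Vec.Base as Vec using (Vec; []; _∷_)
import Data.Vec.Properties as Vec
open import Function.Base using (_∘_; id; case_of_)
open import Function.Bundles using (_⇔_; mk⇔; mk↔ₛ′; module Equivalence)
open import Function.Definitions using (Injective)
open import Level using (0ℓ)
open import Relation.Binary.Bundles using (Setoid)
open import Relation.Binary.Construct.Closure.ReflexiveTransitive
  using (Star; ε; _◅_; _◅◅_; reverse; gmap)
open import Relation.Binary.Core using (Rel)
open import Relation.Binary.Definitions using (DecidableEquality; Symmetric; tri<; tri≈; tri>)
open import Relation.Binary.PropositionalEquality hiding (J; [_])
open import Relation.Nullary
open import Relation.Nullary.Decidable
  using (_×-dec_; decidable-stable; dec-true; dec-false; does-⇔)
open import Relation.Unary using (Pred; Decidable)

private variable
  A B     : Set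
  h m n t : ℕ

-- Counting in finite lists.

lookup-allPairs : ∀ {R : Rel A 0ℓ} {xs} → Symmetric R → AllPairs R xs →
  ∀ i j → i ≢ j → R (lookup xs i) (lookup xs j)
lookup-allPairs s (_ ∷ _) zero zero i≢j = contradiction refl i≢j
lookup-allPairs s (r ∷ _) zero (suc j) i≢j = All.lookup r (∈-lookup j)
lookup-allPairs s (r ∷ _) (suc i) zero i≢j = s (All.lookup r (∈-lookup i))
lookup-allPairs s (_ ∷ rs) (suc i) (suc j) i≢j =
  lookup-allPairs s rs i j (i≢j ∘ cong suc)

lookup-injective : ∀ {xs : List A} → Unique xs → Injective _≡_ _≡_ (lookup xs)
lookup-injective u {i} {j} eq with i Fin.≟ j
... | yes p = p
... | no i≢j = contradiction eq (lookup-allPairs (_∘ sym) u i j i≢j)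

-- No `y` is related to entries at two positions, so choosing a related position in `ys` for each
-- position in `xs` is injective. A relation in place of a function also serves lists that are
-- distinct only up to an equivalence, such as lists of graphs.
length-≤-byRelation : ∀ {R : A → B → Set} {xs ys} →
  AllPairs (λ x x′ → ∀ y → R x y → ¬ R x′ y) xs →
  (∀ {x} → x ∈ˡ xs → ∃[ y ] y ∈ˡ ys × R x y) → length xs ≤ length ys
length-≤-byRelation {R = R} {xs} {ys} sep tot = Fin.injective⇒≤ inj
  where
  image : Fin (length xs) → Fin (length ys)
  image i = Any.index (proj₁ (proj₂ (tot (∈-lookup i))))
  related : ∀ i → R (lookup xs i) (lookup ys (image i))
  related i with tot (∈-lookup i)
  ... | y , y∈ys , r = subst (R _) (lookup-index y∈ys) r
  inj : Injective _≡_ _≡_ image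
  inj {i} {j} eq with i Fin.≟ j
  ... | yes p = p
  ... | no i≢j = contradiction (subst (λ z → R (lookup xs j) (lookup ys z)) (sym eq) (related j))
    (lookup-allPairs (λ h y r r′ → h y r′ r) sep i j i≢j _ (related i))

length-≤-byInjection : ∀ {xs : List A} {ys : List B} (f : A → B) → Injective _≡_ _≡_ f →
  Unique xs → (∀ {x} → x ∈ˡ xs → f x ∈ˡ ys) → length xs ≤ length ys
length-≤-byInjection f inj u h = length-≤-byRelation {R = λ x y → f x ≡ y}
  (AllPairs.map (λ x≢x′ y p q → x≢x′ (inj (trans p (sym q)))) u) (λ x∈ → _ , h x∈ , refl)

module _ {P : Pred A 0ℓ} (P? : Decidable P) where

  length-filter-split : ∀ xs →
    length xs ≡ length (filter P? xs) + length (filter (¬? ∘ P?) xs)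
  length-filter-split [] = refl
  length-filter-split (x ∷ xs) with P? x
  ... | yes _ = cong suc (length-filter-split xs)
  ... | no _ = trans (cong suc (length-filter-split xs)) (sym (+-suc _ _))

  length-filter-filter-≤ : ∀ {Q : Pred A 0ℓ} (Q? : Decidable Q) xs →
    length (filter Q? (filter P? xs)) ≤ length (filter Q? xs)
  length-filter-filter-≤ Q? [] = z≤n
  length-filter-filter-≤ Q? (x ∷ xs) with P? x | Q? x in eq
  ... | yes _ | yes _ rewrite eq = s≤s (length-filter-filter-≤ Q? xs)
  ... | yes _ | no _ rewrite eq = length-filter-filter-≤ Q? xs
  ... | no _ | yes _ = m≤n⇒m≤1+n (length-filter-filter-≤ Q? xs)
  ... | no _ | no _ = length-filter-filter-≤ Q? xs

-- Pigeonhole by recursion on the labels: the elements without the first label are left to the other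
-- labels, and the more popular of the two candidates wins. The label `y₀` is the answer for empty
-- `xs`.
popularLabel : ∀ {R : A → B → Set} (R? : ∀ a b → Dec (R a b)) → B → ∀ xs ys →
  (∀ {x} → x ∈ˡ xs → ∃[ y ] y ∈ˡ ys × R x y) →
  ∃[ y ] length xs ≤ length ys * length (filter (λ x → R? x y) xs)
popularLabel R? y₀ [] ys h = y₀ , z≤n
popularLabel R? y₀ (x ∷ xs) [] h with h (here refl)
... | _ , () , _
popularLabel {R = R} R? y₀ xs@(_ ∷ _) (y ∷ ys) h
  with popularLabel R? y₀ (filter (λ x → ¬? (R? x y)) xs) ys rest
  where
  rest : ∀ {x} → x ∈ˡ filter (λ x → ¬? (R? x y)) xs → ∃[ z ] z ∈ˡ ys × R x z
  rest x∈ with ∈-filter⁻ (λ x → ¬? (R? x y)) x∈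
  ... | x∈xs , ¬r with h x∈xs
  ... | _ , here refl , r = contradiction r ¬r
  ... | z , there z∈ , r = z , z∈ , r
... | z , bound with ≤-total (length (filter (λ x → R? x z) xs)) (length (filter (λ x → R? x y) xs))
... | inj₁ z≤y = y , (begin
  length xs ≡⟨ length-filter-split (λ x → R? x y) xs ⟩
  count y + length (filter (λ x → ¬? (R? x y)) xs)
    ≤⟨ +-monoʳ-≤ (count y) (≤-trans bound (*-monoʳ-≤ (length ys)
         (≤-trans (length-filter-filter-≤ (λ w → ¬? (R? w y)) (λ w → R? w z) xs) z≤y))) ⟩
  count y + length ys * count y ∎)
  where
  open ≤-Reasoning
  count = λ w → length (filter (λ x → R? x w) xs)
... | inj₂ y≤z = z , (begin
  length xs ≡⟨ length-filter-split (λ x → R? x y) xs ⟩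
  count y + length (filter (λ x → ¬? (R? x y)) xs)
    ≤⟨ +-mono-≤ y≤z (≤-trans bound (*-monoʳ-≤ (length ys)
         (length-filter-filter-≤ (λ w → ¬? (R? w y)) (λ w → R? w z) xs))) ⟩
  count z + length ys * count z ∎)
  where
  open ≤-Reasoning
  count = λ w → length (filter (λ x → R? x w) xs)

length-allFin : ∀ n → length (allFin n) ≡ n
length-allFin n = length-tabulate id

length-cartesianProductWith : ∀ {C : Set} (f : A → B → C) xs ys →
  length (cartesianProductWith f xs ys) ≡ length xs * length ys
length-cartesianProductWith f [] ys = refl
length-cartesianProductWith f (x ∷ xs) ys = trans (length-++ (map (f x) ys))
  (cong₂ _+_ (length-map (f x) ys) (length-cartesianProductWith f xs ys))

length-vecs : (xs : List A) → ∀ n → length (vecs xs n) ≡ length xs ^ n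
length-vecs xs zero = refl
length-vecs xs (suc n) = trans (length-cartesianProductWith _∷_ xs (vecs xs n))
  (cong (length xs *_) (length-vecs xs n))

∈-vecs : ∀ {xs : List A} {n} (v : Vec A n) → (∀ i → Vec.lookup v i ∈ˡ xs) → v ∈ˡ vecs xs n
∈-vecs [] h = here refl
∈-vecs (x ∷ v) h = ∈-cartesianProductWith⁺ _∷_ (h zero) (∈-vecs v (h ∘ suc))

vecs-unique : ∀ {xs : List A} → Unique xs → ∀ n → Unique (vecs xs n)
vecs-unique u zero = [] ∷ []
vecs-unique u (suc n) = Unique.cartesianProductWith⁺ _∷_ (λ { refl → refl , refl }) u (vecs-unique u n)

fresh : ∀ {n} (xs : List (Fin n)) → length xs < n → ∃[ z ] z ∉ˡ xs
fresh {n} xs xs<n with Fin.any? (λ z → ¬? (Any.any? (z Fin.≟_) xs))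
... | yes p = p
... | no all∈ = contradiction xs<n (≤⇒≯ (subst (_≤ length xs) (length-allFin n)
  (length-≤-byInjection id id (Unique.allFin⁺ n)
    (λ {z} _ → decidable-stable (Any.any? (z Fin.≟_) xs) (λ z∉ → all∈ (z , z∉))))))

∉⇒All≢ : ∀ {x : A} {xs} → x ∉ˡ xs → All (x ≢_) xs
∉⇒All≢ x∉ = All.tabulate (λ { y∈ refl → x∉ y∈ })

-- Whenever an entry is already covered, a fresh element takes its slot, so the length comes out as
-- exactly `m`.
uniqueCover : ∀ {m n} (xs : List (Fin n)) → length xs ≤ m → m ≤ n →
  ∃[ ys ] Unique ys × length ys ≡ m × (∀ {x} → x ∈ˡ xs → x ∈ˡ ys)
uniqueCover {m} {n} [] _ m≤n = tabulate (λ i → inject≤ i m≤n) ,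
  Unique.tabulate⁺ (Fin.inject≤-injective m≤n m≤n _ _) , length-tabulate _ , λ ()
uniqueCover {suc m} (x ∷ xs) (s≤s xs≤m) m<n with uniqueCover xs xs≤m (<⇒≤ m<n)
... | ys , u , refl , cover with Any.any? (x Fin.≟_) ys
... | no x∉ = x ∷ ys , ∉⇒All≢ x∉ ∷ u , refl , λ { (here p) → here p ; (there q) → there (cover q) }
... | yes x∈ with fresh ys m<n
... | z , z∉ = z ∷ ys , ∉⇒All≢ z∉ ∷ u , refl , λ { (here refl) → there x∈ ; (there q) → there (cover q) }

injectionCovering : ∀ {m n} (xs : List (Fin n)) → length xs ≤ m → m ≤ n →
  Σ (Fin m → Fin n) λ φ → Injective _≡_ _≡_ φ × (∀ {x} → x ∈ˡ xs → ∃[ i ] φ i ≡ x)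
injectionCovering xs xs≤m m≤n with uniqueCover xs xs≤m m≤n
... | ys , u , refl , cover = lookup ys , lookup-injective u ,
  λ x∈ → Any.index (cover x∈) , sym (lookup-index (cover x∈))

module _ (_≟_ : DecidableEquality A) where

  override : {B : Set} → A → B → (A → B) → A → B
  override a b f x = if does (x ≟ a) then b else f x

  override-at : ∀ {B : Set} a (b : B) f → override a b f a ≡ b
  override-at a b f with a ≟ a
  ... | yes _ = refl
  ... | no a≢a = contradiction refl a≢a

  override-off : ∀ {B : Set} a (b : B) f {x} → x ≢ a → override a b f x ≡ f x
  override-off a b f {x} x≢a with x ≟ a
  ... | yes x≡a = contradiction x≡a x≢a
  ... | no _ = refl

-- Rooted orders of trees.

Adj-sym : ∀ {n} (G : Graph n) {x y} → Adj G x y → Adj G y x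
Adj-sym G {x} {y} a = trans (adj-sym G y x) a

record RootedOrder {t} (T : Graph t) : Set where
  field
    rank           : Fin t → ℕ
    rank-injective : Injective _≡_ _≡_ rank
    rank-<         : ∀ x → rank x < t
    parent         : Fin t → Fin t
    -- For the root this is an arbitrary neighbour, of larger rank.
    parent-adj     : ∀ x → Adj T x (parent x)
    adj-parent     : ∀ {x y} → Adj T x y →
      (parent x ≡ y × rank y < rank x) ⊎ (parent y ≡ x × rank x < rank y)

module _ {t} {T : Graph t} where

  data Path : Fin t → Fin t → List (Fin t) → Set where
    stop : ∀ {x} → Path x x (x ∷ [])
    _◂_ : ∀ {x z y l} → Adj T x z → Path z y l → Path x y (x ∷ l)

  path-suffix : ∀ {x z y l} → x ∈ˡ l → Path z y l →
    ∃[ l′ ] Path x y l′ × (∀ {w} → w ∈ˡ l′ → w ∈ˡ l) × (Unique l → Unique l′)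
  path-suffix (here refl) p@stop = _ , p , id , id
  path-suffix (here refl) p@(_ ◂ _) = _ , p , id , id
  path-suffix (there x∈) (_ ◂ p) with path-suffix x∈ p
  ... | l′ , q , l′⊆l , u = l′ , q , there ∘ l′⊆l , λ { (_ ∷ v) → u v }

  Within : List (Fin t) → Fin t → Fin t → Set
  Within xs x y = Adj T x y × x ∈ˡ xs × y ∈ˡ xs

  -- If the first vertex recurs on the path already made simple, that path is cut down to its suffix
  -- from there.
  loopErasure : ∀ {xs x y} → y ∈ˡ xs → Star (Within xs) x y →
    ∃[ l ] Path x y l × Unique l × (∀ {w} → w ∈ˡ l → w ∈ˡ xs)
  loopErasure y∈ ε = _ , stop , [] ∷ [] , λ { (here refl) → y∈ }
  loopErasure {x = x} y∈ ((a , x∈ , _) ◅ s) with loopErasure y∈ s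
  ... | l , p , u , l⊆ with Any.any? (x Fin.≟_) l
  ... | yes x∈l with path-suffix x∈l p
  ... | l′ , q , l′⊆l , u′ = l′ , q , u′ u , l⊆ ∘ l′⊆l
  loopErasure {x = x} y∈ ((a , x∈ , _) ◅ s) | l , p , u , l⊆ | no x∉l =
    x ∷ l , a ◂ p , ∉⇒All≢ x∉l ∷ u , λ { (here refl) → x∈ ; (there w∈) → l⊆ w∈ }

  path-consecutive : ∀ {x y z l} → Path x y (z ∷ l) → (i : Fin (length l)) →
    Adj T (lookup (z ∷ l) (inject₁ i)) (lookup (z ∷ l) (suc i))
  path-consecutive (a ◂ stop) zero = a
  path-consecutive (a ◂ (_ ◂ _)) zero = a
  path-consecutive (a ◂ p@(_ ◂ _)) (suc i) = path-consecutive p i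

  path-last : ∀ {x y z l} → Path x y (z ∷ l) → lookup (z ∷ l) (fromℕ (length l)) ≡ y
  path-last stop = refl
  path-last (a ◂ p@stop) = path-last p
  path-last (a ◂ p@(_ ◂ _)) = path-last p

  -- Since `x ≢ y`, the path has at least two vertices, and together with `z` they form a cycle of
  -- length at least three.
  closePath : ∀ {x y z l} → Path x y l → Unique l → x ≢ y → z ∉ˡ l →
    Adj T z x → Adj T z y → Cycle T
  closePath stop _ x≢y _ _ _ = contradiction refl x≢y
  closePath {x = x} {z = z} p@(_◂_ {l = w ∷ l} _ _) u x≢y z∉ zx zy =
    length l , lookup (z ∷ x ∷ w ∷ l) , lookup-injective (∉⇒All≢ z∉ ∷ u) , path-consecutive (zx ◂ p) ,
    Adj-sym T (subst (Adj T z) (sym (path-last (zx ◂ p))) zy)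

  -- The tree is exhausted by adding one leaf at a time; the rank of a vertex is
  -- the stage at which it is added.
  record Grown (xs : List (Fin t)) : Set where
    field
      rank           : Fin t → ℕ
      rank-injective : ∀ {x y} → x ∈ˡ xs → y ∈ˡ xs → rank x ≡ rank y → x ≡ y
      rank-<         : ∀ {x} → x ∈ˡ xs → rank x < length xs
      parent         : Fin t → Fin t
      parent-adj     : ∀ x → Adj T x (parent x)
      adj-parent     : ∀ {x y} → x ∈ˡ xs → y ∈ˡ xs → Adj T x y →
        (parent x ≡ y × rank y < rank x) ⊎ (parent y ≡ x × rank x < rank y)
      unique         : Unique xs
      base           : Fin t
      base∈          : base ∈ˡ xs
      connected      : ∀ {x} → x ∈ˡ xs → Star (Within xs) base x

  -- Two different neighbours of `y` would be joined by a simple path inside `xs`, and `y` would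
  -- close it to a cycle.
  uniqueNeighbour : ∀ {xs y} → ¬ Cycle T → Grown xs → y ∉ˡ xs →
    ∀ {q z} → q ∈ˡ xs → z ∈ˡ xs → Adj T y q → Adj T y z → q ≡ z
  uniqueNeighbour acyclic g y∉ {q} {z} q∈ z∈ yq yz with q Fin.≟ z
  ... | yes p = p
  ... | no q≢z with loopErasure z∈
    (reverse (λ { (a , x∈ , y∈) → Adj-sym T a , y∈ , x∈ }) (connected q∈) ◅◅ connected z∈)
    where open Grown g
  ... | l , p , u , l⊆ = contradiction (closePath p u q≢z (y∉ ∘ l⊆) yq yz) acyclic

  -- The new vertex gets the largest rank so far, and by `uniqueNeighbour` its only edge to the
  -- earlier vertices goes to its parent.
  grow : ∀ {xs y q} → ¬ Cycle T → Grown xs → y ∉ˡ xs → q ∈ˡ xs → Adj T y q → Grown (y ∷ xs)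
  grow {xs} {y} {q} acyclic g y∉ q∈ yq = record
    { rank = rank′
    ; rank-injective = inj
    ; rank-< = bound
    ; parent = parent′
    ; parent-adj = padj
    ; adj-parent = adjp
    ; unique = ∉⇒All≢ y∉ ∷ G.unique
    ; base = G.base
    ; base∈ = there G.base∈
    ; connected = conn
    }
    where
    module G = Grown g
    rank′ = override Fin._≟_ y (length xs) G.rank
    parent′ = override Fin._≟_ y q G.parent
    old : ∀ {x} → x ∈ˡ xs → x ≢ y
    old x∈ refl = y∉ x∈
    rank-new : rank′ y ≡ length xs
    rank-new = override-at Fin._≟_ y _ G.rank
    rank-old : ∀ {x} → x ∈ˡ xs → rank′ x ≡ G.rank x
    rank-old x∈ = override-off Fin._≟_ y _ G.rank (old x∈)
    rank-old< : ∀ {x} → x ∈ˡ xs → rank′ x < rank′ y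
    rank-old< x∈ = subst₂ _<_ (sym (rank-old x∈)) (sym rank-new) (G.rank-< x∈)
    bound : ∀ {x} → x ∈ˡ y ∷ xs → rank′ x < suc (length xs)
    bound (here refl) = s≤s (≤-reflexive rank-new)
    bound (there x∈) = m≤n⇒m≤1+n (subst (_< _) (sym (rank-old x∈)) (G.rank-< x∈))
    inj : ∀ {u v} → u ∈ˡ y ∷ xs → v ∈ˡ y ∷ xs → rank′ u ≡ rank′ v → u ≡ v
    inj (here refl) (here refl) _ = refl
    inj (here refl) (there v∈) eq = contradiction (sym eq) (<⇒≢ (rank-old< v∈))
    inj (there u∈) (here refl) eq = contradiction eq (<⇒≢ (rank-old< u∈))
    inj (there u∈) (there v∈) eq =
      G.rank-injective u∈ v∈ (trans (sym (rank-old u∈)) (trans eq (rank-old v∈)))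
    parent-new : parent′ y ≡ q
    parent-new = override-at Fin._≟_ y _ G.parent
    padj : ∀ x → Adj T x (parent′ x)
    padj x with x Fin.≟ y
    ... | yes refl = yq
    ... | no _ = G.parent-adj x
    toNew : ∀ {u} → u ∈ˡ xs → Adj T y u → parent′ y ≡ u × rank′ u < rank′ y
    toNew u∈ yu = trans parent-new (uniqueNeighbour acyclic g y∉ q∈ u∈ yq yu) , rank-old< u∈
    adjp : ∀ {u v} → u ∈ˡ y ∷ xs → v ∈ˡ y ∷ xs → Adj T u v →
      (parent′ u ≡ v × rank′ v < rank′ u) ⊎ (parent′ v ≡ u × rank′ u < rank′ v)
    adjp (here refl) (here refl) a = contradiction (trans (sym a) (adj-irrefl T y)) λ ()
    adjp (here refl) (there v∈) a = inj₁ (toNew v∈ a)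
    adjp (there u∈) (here refl) a = inj₂ (toNew u∈ (Adj-sym T a))
    adjp (there u∈) (there v∈) a
      rewrite rank-old u∈ | rank-old v∈
            | override-off Fin._≟_ y q G.parent (old u∈) | override-off Fin._≟_ y q G.parent (old v∈)
      = G.adj-parent u∈ v∈ a
    conn : ∀ {x} → x ∈ˡ y ∷ xs → Star (Within (y ∷ xs)) G.base x
    conn x∈ = [ (λ { refl → lift (G.connected q∈) ◅◅ ((Adj-sym T yq , there q∈ , here refl) ◅ ε) })
              , lift ∘ G.connected ]′ (split x∈)
      where
      split : ∀ {x} → x ∈ˡ y ∷ xs → (x ≡ y) ⊎ x ∈ˡ xs
      split (here p) = inj₁ p
      split (there p) = inj₂ p
      lift : ∀ {u v} → Star (Within xs) u v → Star (Within (y ∷ xs)) u v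
      lift = gmap id (λ { (a , u∈ , v∈) → a , there u∈ , there v∈ })

  crossing : ∀ {xs x y} → Star (Adj T) x y → x ∈ˡ xs → y ∉ˡ xs →
    ∃[ a ] ∃[ b ] a ∈ˡ xs × b ∉ˡ xs × Adj T a b
  crossing ε x∈ y∉ = contradiction x∈ y∉
  crossing {xs} {x} (_◅_ {j = z} xz s) x∈ y∉ with Any.any? (z Fin.≟_) xs
  ... | yes z∈ = crossing s z∈ y∉
  ... | no z∉ = x , z , x∈ , z∉ , xz

  -- As long as a vertex is missing, a walk from `base` to it crosses an edge that leaves `xs`; its
  -- outer end is added. The number `j` counts the missing vertices.
  growAll : IsTree T → ∀ j {xs} → Grown xs → length xs + j ≡ t → ∃[ ys ] Grown ys × length ys ≡ t
  growAll tree zero {xs} g eq = xs , g , trans (sym (+-identityʳ _)) eq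
  growAll tree@((_ , conn) , acyclic) (suc j) {xs} g eq
    with fresh xs (subst (length xs <_) eq (m<m+n (length xs) z<s))
  ... | v , v∉ with crossing (conn (Grown.base g) v) (Grown.base∈ g) v∉
  ... | a , b , a∈ , b∉ , ab =
    growAll tree j (grow acyclic g b∉ a∈ (Adj-sym T ab)) (trans (sym (+-suc _ j)) eq)

hasNeighbour : ∀ {t} {T : Graph t} → Connected T → ∀ {x z} → z ≢ x → ∃[ y ] Adj T x y
hasNeighbour (_ , conn) {x} {z} z≢x with conn x z
... | ε = contradiction refl z≢x
... | a ◅ _ = _ , a

another : ∀ {t} (x : Fin (2 + t)) → ∃[ z ] z ≢ x
another zero = suc zero , λ ()
another (suc x) = zero , λ ()

rootedOrder : ∀ {t} {T : Graph t} → IsTree T → ¬ (T ≅ K₁) → RootedOrder T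
rootedOrder {zero} ((() , _) , _)
rootedOrder {1} {T} _ T≇K₁ = contradiction
  (mk↔ₛ′ id id (λ _ → refl) (λ _ → refl) , λ { zero zero → adj-irrefl T zero }) T≇K₁
rootedOrder {suc (suc t)} {T} tree@(conn , _) _ = record
  { rank = G.rank
  ; rank-injective = G.rank-injective (all∈ _) (all∈ _)
  ; rank-< = λ x → subst (G.rank x <_) |xs|≡t (G.rank-< (all∈ x))
  ; parent = G.parent
  ; parent-adj = G.parent-adj
  ; adj-parent = G.adj-parent (all∈ _) (all∈ _)
  }
  where
  -- With at least two vertices every vertex has a neighbour, which gives the starting vertex a
  -- value of `parent`.
  neighbour : ∀ x → ∃[ y ] Adj T x y
  neighbour x = hasNeighbour {T = T} conn (proj₂ (another x))
  single : Grown {T = T} (zero ∷ [])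
  single = record
    { rank = λ _ → 0
    ; rank-injective = λ { (here refl) (here refl) _ → refl }
    ; rank-< = λ _ → z<s
    ; parent = proj₁ ∘ neighbour
    ; parent-adj = proj₂ ∘ neighbour
    ; adj-parent = λ { (here refl) (here refl) a →
        contradiction (trans (sym a) (adj-irrefl T zero)) λ () }
    ; unique = [] ∷ []
    ; base = zero
    ; base∈ = here refl
    ; connected = λ { (here refl) → ε }
    }
  all = growAll tree (suc t) single refl
  xs = proj₁ all
  module G = Grown (proj₁ (proj₂ all))
  |xs|≡t = proj₂ (proj₂ all)
  all∈ : ∀ x → x ∈ˡ xs
  all∈ x with Any.any? (x Fin.≟_) xs
  ... | yes x∈ = x∈
  ... | no x∉ = contradiction
    (subst (length (x ∷ xs) ≤_) (length-allFin _)
      (length-≤-byInjection id id (∉⇒All≢ x∉ ∷ G.unique) (λ {z} _ → ∈-allFin z)))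
    (subst (λ m → ¬ suc m ≤ 2 + t) (sym |xs|≡t) 1+n≰n)

-- Tops, hitting edges and components outside a kernel.

-- The tops of U are the vertices of least rank in the components of T outside U.
module _ {t} {T : Graph t} (R : RootedOrder T) where
  open RootedOrder R

  Top : Subset t → Fin t → Set
  Top U v = v ∉ U × (rank (parent v) < rank v → parent v ∈ U)

  ContainsEdges : Subset t → List (Fin t) → Set
  ContainsEdges U vs = All (λ v → v ∈ U × parent v ∈ U) vs

  module _ (em : ExcludedMiddle 0ℓ) (P : Subset t → Set)
           (proper : ∀ {U} → P U → ∃[ x ] x ∉ U)
           (∩-closed : ∀ {U V} → P U → P V → P (U ∩ V)) where

    Above : ℕ → Subset t → Set
    Above d U = ∀ {x} → x ∉ U → d ≤ rank x

    -- State of a scan that has come down to rank `d`. A vertex of `vs` stands for the edge to its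
    -- parent; these edges meet the complement of every `U` in `P` that misses only ranks from `d`
    -- on. The set `kernel` is an intersection of members of `P`, with `⊤` as the empty one.
    record Hitting (d : ℕ) : Set where
      field
        vs     : List (Fin t)
        kernel : Subset t
        kernel-P : kernel ≡ ⊤ ⊎ P kernel
        unique : Unique vs
        tops   : All (Top kernel) vs
        above  : Above d kernel
        hits   : ∀ {U} → P U → Above d U → ¬ ContainsEdges U vs

    -- Scanning the ranks downwards, the smallest vertex outside an unhit U stays
    -- a top of every intersection formed from then on, since the earlier complements
    -- have larger ranks and the later ones avoid its edge.
    hitting-step : ∀ {d} → Hitting (suc d) → Hitting d
    hitting-step {d} h with em {∃[ U ] P U × Above d U × ContainsEdges U (Hitting.vs h)}
    ... | no none = record
      { vs = vs ; kernel = kernel ; kernel-P = kernel-P ; unique = unique ; tops = tops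
      ; above = <⇒≤ ∘ above
      ; hits = λ pU aU cU → none (_ , pU , aU , cU) }
      where open Hitting h
    ... | yes (U , pU , aU , cU) with em {∃[ v ] v ∉ U × rank v ≡ d}
    -- If `U` misses no vertex of rank `d`, it was within the range of the previous stage and is
    -- already hit.
    ... | no none = contradiction cU
      (Hitting.hits h pU (λ {x} x∉ → ≤∧≢⇒< (aU x∉) (λ eq → none (x , x∉ , sym eq))))
    ... | yes (v , v∉U , refl) = record
      { vs = v ∷ vs
      ; kernel = kernel ∩ U
      ; kernel-P = inj₂ ([ (λ { refl → subst P (sym (∩-identityˡ U)) pU }) , (λ pB → ∩-closed pB pU) ]′ kernel-P)
      ; unique = ∉⇒All≢ (λ v∈ → v∉U (proj₁ (All.lookup cU v∈))) ∷ unique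
      ; tops = ((v∉U ∘ proj₂ ∘ x∈p∩q⁻ kernel U) , λ lt → x∈p∩q⁺ (inSet kernel (above′ lt) , inSet U (aU′ lt)))
          ∷ All.tabulate (λ {w} w∈ → let (w∉ , w-top) = All.lookup tops w∈ in
              (w∉ ∘ proj₁ ∘ x∈p∩q⁻ kernel U) , λ lt → x∈p∩q⁺ (w-top lt , proj₂ (All.lookup cU w∈)))
      ; above = λ {x} x∉ → decidable-stable (rank v ≤? rank x) (λ v≰x →
          x∉ (x∈p∩q⁺ ( decidable-stable (x ∈? kernel) (λ x∉B → v≰x (<⇒≤ (above x∉B)))
                     , decidable-stable (x ∈? U) (λ x∉U → v≰x (aU x∉U)))))
      -- A set `V` containing the edge at `v` misses no vertex of rank `d`, so the earlier edges hit
      -- it.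
      ; hits = λ { {V} pV aV (cv ∷ cV) → hits pV (λ {x} x∉V → ≤∧≢⇒< (aV x∉V) (λ eq →
          x∉V (subst (_∈ V) (rank-injective eq) (proj₁ cv)))) cV }
      }
      where
      open Hitting h
      inSet : ∀ B {x} → ¬ (x ∉ B) → x ∈ B
      inSet B {x} = decidable-stable (x ∈? B)
      above′ : rank (parent v) < rank v → ¬ (parent v ∉ kernel)
      above′ lt p∉ = <-asym lt (above p∉)
      aU′ : rank (parent v) < rank v → ¬ (parent v ∉ U)
      aU′ lt p∉ = <⇒≱ lt (aU p∉)

    hitting : ∀ j d → d + j ≡ t → Hitting d
    hitting zero d eq = record
      { vs = [] ; kernel = ⊤ ; kernel-P = inj₁ refl ; unique = [] ; tops = []
      ; above = λ x∉ → contradiction ∈⊤ x∉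
      ; hits = λ pU aU _ → let (x , x∉) = proper pU in
          <⇒≱ (rank-< x) (subst (_≤ rank x) (trans (sym (+-identityʳ d)) eq) (aU x∉)) }
    hitting (suc j) d eq = hitting-step (hitting j (suc d) (trans (sym (+-suc d j)) eq))

    -- The edges chosen by the scan start at distinct tops of one member of `P`, so the bound on
    -- tops bounds their number. If the intersection is still `⊤`, there are no tops, hence no
    -- edges, and `0 < k` suffices.
    hittingEdges : ∀ {k} → 0 < k →
      (∀ {U} → P U → ∀ {vs} → Unique vs → All (Top U) vs → length vs < k) →
      ∃[ vs ] length vs < k × (∀ {U} → P U → ¬ ContainsEdges U vs)
    hittingEdges {k} 0<k fewTops = vs ,
      [ (λ B≡⊤ → subst (_< k) (sym (noTops B≡⊤ tops)) 0<k) , (λ pB → fewTops pB unique tops) ]′ kernel-P ,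
      λ pU → hits pU (λ _ → z≤n)
      where
      open Hitting (hitting t 0 refl)
      noTops : ∀ {B ws} → B ≡ ⊤ → All (Top B) ws → length ws ≡ 0
      noTops refl [] = refl
      noTops refl ((w∉ , _) ∷ _) = contradiction ∈⊤ w∉

  module _ (U : Subset t) where

    climb : ℕ → Fin t → Fin t
    climb zero v = v
    climb (suc j) v with parent v ∈? U | rank (parent v) <? rank v
    ... | no _ | yes _ = climb j (parent v)
    ... | _    | _     = v

    -- Every move lowers the rank, so fuel beyond the rank of `v` changes nothing.
    climb-stable : ∀ j v → rank v ≤ j → climb (suc j) v ≡ climb j v
    climb-stable zero v r≤ with parent v ∈? U | rank (parent v) <? rank v
    ... | no _  | yes lt = contradiction (<-≤-trans lt r≤) λ ()
    ... | no _  | no _ = refl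
    ... | yes _ | _ = refl
    climb-stable (suc j) v r≤ with parent v ∈? U | rank (parent v) <? rank v
    ... | no _ | yes lt = climb-stable j (parent v) (s≤s⁻¹ (<-≤-trans lt r≤))
    ... | no _ | no _ = refl
    ... | yes _ | _ = refl

    -- For `v` outside `U` this names the component of `T` outside `U` that contains `v`. The fuel
    -- `suc t` exceeds every rank.
    componentRoot : Fin t → Fin t
    componentRoot = climb (suc t)

    componentRoot-parent : ∀ {v} → parent v ∉ U → rank (parent v) < rank v →
      componentRoot v ≡ componentRoot (parent v)
    componentRoot-parent {v} p∉ lt = trans step (sym (climb-stable t (parent v) (<⇒≤ (rank-< (parent v)))))
      where
      step : climb (suc t) v ≡ climb t (parent v)
      step with parent v ∈? U | rank (parent v) <? rank v
      ... | yes p∈ | _ = contradiction p∈ p∉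
      ... | no _ | no ≮ = contradiction lt ≮
      ... | no _ | yes _ = refl

    componentRoot-top : ∀ {v} → Top U v → componentRoot v ≡ v
    componentRoot-top {v} (_ , top) with parent v ∈? U | rank (parent v) <? rank v
    ... | no p∉ | yes lt = contradiction (top lt) p∉
    ... | no _ | no _ = refl
    ... | yes _ | _ = refl

    componentRoot-adj : ∀ {x y} → x ∉ U → y ∉ U → Adj T x y → componentRoot x ≡ componentRoot y
    componentRoot-adj x∉ y∉ xy with adj-parent xy
    ... | inj₁ (refl , lt) = componentRoot-parent y∉ lt
    ... | inj₂ (refl , lt) = sym (componentRoot-parent x∉ lt)

-- Embeddings, copies and the list of all graphs.

module _ {P : Pred (Fin n) 0ℓ} (P? : Decidable P) where

  ⟦_⟧ : Subset n
  ⟦_⟧ = Vec.tabulate (does ∘ P?)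

  ∈⟦⟧⁺ : ∀ {x} → P x → x ∈ ⟦_⟧
  ∈⟦⟧⁺ {x} px = Vec.lookup⇒[]= x _ (trans (Vec.lookup∘tabulate _ x) (dec-true (P? x) px))

  ∈⟦⟧⁻ : ∀ {x} → x ∈ ⟦_⟧ → P x
  ∈⟦⟧⁻ {x} x∈ with P? x | trans (sym (Vec.lookup∘tabulate (does ∘ P?) x)) (Vec.[]=⇒lookup x∈)
  ... | yes px | _ = px

IsEmbedding : Graph h → Graph n → (Fin h → Fin n) → Set
IsEmbedding H G f = Injective _≡_ _≡_ f × (∀ {u v} → Adj H u v → Adj G (f u) (f v))

_≗ᴳ_ : Graph n → Graph n → Set
G ≗ᴳ G′ = ∀ x y → adj G x y ≡ adj G′ x y

module _ (M : Vec (Subset n) n) where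

  private
    entry = λ x y → Vec.lookup (Vec.lookup M x) y

  fromMatrix-adj : ∀ {G} → fromMatrix M ≡ just G → ∀ x y → adj G x y ≡ entry x y
  fromMatrix-adj eq
    with Fin.all? (λ x → Fin.all? λ y → entry x y Bool.≟ entry y x)
       | Fin.all? (λ x → entry x x Bool.≟ false)
  fromMatrix-adj refl | yes _ | yes _ = λ _ _ → refl

  fromMatrix-just : (∀ x y → entry x y ≡ entry y x) → (∀ x → entry x x ≡ false) →
    ∃[ G ] fromMatrix M ≡ just G
  fromMatrix-just s i
    with Fin.all? (λ x → Fin.all? λ y → entry x y Bool.≟ entry y x)
       | Fin.all? (λ x → entry x x Bool.≟ false)
  ... | yes _ | yes _ = _ , refl
  ... | yes _ | no ¬i = contradiction i ¬i
  ... | no ¬s | _ = contradiction s ¬s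

lookup-ext : ∀ {v w : Vec A n} → (∀ i → Vec.lookup v i ≡ Vec.lookup w i) → v ≡ w
lookup-ext {v = v} {w} eq =
  trans (sym (Vec.tabulate∘lookup v)) (trans (Vec.tabulate-cong eq) (Vec.tabulate∘lookup w))

∈-mapMaybe : ∀ {f : A → Maybe B} {x y xs} → x ∈ˡ xs → f x ≡ just y → y ∈ˡ mapMaybe f xs
∈-mapMaybe {f = f} {x} (here refl) eq with f x
∈-mapMaybe (here refl) refl | just _ = here refl
∈-mapMaybe {f = f} {xs = z ∷ _} (there x∈) eq with f z
... | just _ = there (∈-mapMaybe x∈ eq)
... | nothing = ∈-mapMaybe x∈ eq

∈-mapMaybe⁻ : ∀ {f : A → Maybe B} {y} xs → y ∈ˡ mapMaybe f xs → ∃[ x ] x ∈ˡ xs × f x ≡ just y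
∈-mapMaybe⁻ {f = f} (x ∷ xs) y∈ with f x in eq
∈-mapMaybe⁻ (x ∷ xs) (here refl) | just _ = x , here refl , eq
∈-mapMaybe⁻ (x ∷ xs) (there y∈) | just _ with ∈-mapMaybe⁻ xs y∈
... | z , z∈ , p = z , there z∈ , p
∈-mapMaybe⁻ (x ∷ xs) y∈ | nothing with ∈-mapMaybe⁻ xs y∈
... | z , z∈ , p = z , there z∈ , p

bools-complete : ∀ b → b ∈ˡ false ∷ true ∷ []
bools-complete false = here refl
bools-complete true = there (here refl)

∈-subsets : (S : Subset n) → S ∈ˡ subsets n
∈-subsets S = ∈-vecs S (λ i → bools-complete (Vec.lookup S i))

subsets-unique : ∀ n → Unique (subsets n)
subsets-unique = vecs-unique (((λ ()) ∷ []) ∷ [] ∷ [])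

-- A graph is a function with proofs attached, so it is found in the list only up to pointwise
-- equality of adjacency.
∈-graphs : (G : Graph n) → ∃[ G′ ] G′ ∈ˡ graphs n × G ≗ᴳ G′
∈-graphs {n} G =
  let (G′ , eq) = fromMatrix-just matrix
        (λ x y → trans (entry x y) (trans (adj-sym G x y) (sym (entry y x))))
        (λ x → trans (entry x x) (adj-irrefl G x))
  in G′ , ∈-mapMaybe (∈-vecs matrix (λ i → ∈-subsets (Vec.lookup matrix i))) eq ,
     λ x y → sym (trans (fromMatrix-adj matrix eq x y) (entry x y))
  where
  row : Fin n → Subset n
  row x = Vec.tabulate (adj G x)
  matrix : Vec (Subset n) n
  matrix = Vec.tabulate row
  entry : ∀ x y → Vec.lookup (Vec.lookup matrix x) y ≡ adj G x y
  entry x y = trans (cong (λ r → Vec.lookup r y) (Vec.lookup∘tabulate row x))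
    (Vec.lookup∘tabulate (adj G x) y)

graphs-distinct : ∀ n → AllPairs (λ G G′ → ¬ G ≗ᴳ G′) (graphs n)
graphs-distinct n = go (vecs-unique (subsets-unique n) n)
  where
  go : ∀ {Ms} → Unique Ms → AllPairs (λ G G′ → ¬ G ≗ᴳ G′) (mapMaybe fromMatrix Ms)
  go [] = []
  go (_∷_ {M} {Ms} M∉ u) with fromMatrix M in eq
  ... | nothing = go u
  ... | just G = All.tabulate (λ G′∈ G≗G′ → distinct (∈-mapMaybe⁻ Ms G′∈) G≗G′) ∷ go u
    where
    distinct : ∀ {G′} → (∃[ M′ ] M′ ∈ˡ Ms × fromMatrix M′ ≡ just G′) → ¬ G ≗ᴳ G′
    distinct (M′ , M′∈ , eq′) G≗G′ = All.lookup M∉ M′∈ (lookup-ext λ x → lookup-ext λ y →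
      trans (sym (fromMatrix-adj M eq x y)) (trans (G≗G′ x y) (fromMatrix-adj M′ eq′ x y)))

module _ {H : Graph h} {G : Graph n} where

  copyEmbedding : ∀ C → ((f , _) : H IsoToSub C) → C IsSubgraphOf G → IsEmbedding H G f
  copyEmbedding _ (f , inj , _ , iso) sub = inj ,
    λ {u} {v} uv → proj₂ (proj₂ (sub (f u) (f v) (trans (sym (iso u v)) uv)))

  -- All edges of a candidate that is a copy lie inside its vertex set, which is the image, so the
  -- isomorphism fixes the edge set everywhere.
  copy-determined : ∀ {S S′ E E′} → IsCopy H G (S , E) → IsCopy H G (S′ , E′) →
    ∀ {f f′ : Fin h → Fin n} → f ≗ f′ →
    (∀ x → x ∈ S ⇔ (∃[ u ] f u ≡ x)) → (∀ u v → adj H u v ≡ adj E (f u) (f v)) →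
    (∀ x → x ∈ S′ ⇔ (∃[ u ] f′ u ≡ x)) → (∀ u v → adj H u v ≡ adj E′ (f′ u) (f′ v)) →
    S ≡ S′ × E ≗ᴳ E′
  copy-determined {S} {S′} {E} {E′} (sub , _) (sub′ , _) {f} {f′} f≗f′ im iso im′ iso′ =
    ⊆-antisym (transfer im im′ f≗f′) (transfer im′ im (sym ∘ f≗f′)) , same
    where
    transfer : ∀ {S S′} {f f′ : Fin h → Fin n} → (∀ x → x ∈ S ⇔ (∃[ u ] f u ≡ x)) →
      (∀ x → x ∈ S′ ⇔ (∃[ u ] f′ u ≡ x)) → f ≗ f′ → ∀ {x} → x ∈ S → x ∈ S′
    transfer im im′ eq {x} x∈ with Equivalence.to (im x) x∈
    ... | u , refl = Equivalence.from (im′ x) (u , sym (eq u))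
    half : ∀ {S E E′} {f f′ : Fin h → Fin n} → (S , E) IsSubgraphOf G → f ≗ f′ →
      (∀ x → x ∈ S ⇔ (∃[ u ] f u ≡ x)) → (∀ u v → adj H u v ≡ adj E (f u) (f v)) →
      (∀ u v → adj H u v ≡ adj E′ (f′ u) (f′ v)) → ∀ x y → Adj E x y → Adj E′ x y
    half {E′ = E′} sub eq im iso iso′ x y xy with sub x y xy
    ... | x∈ , y∈ , _ with Equivalence.to (im x) x∈ | Equivalence.to (im y) y∈
    ... | u , refl | v , refl = subst₂ (Adj E′) (sym (eq u)) (sym (eq v))
      (trans (sym (iso′ u v)) (trans (iso u v) xy))
    same : E ≗ᴳ E′
    same x y with adj E x y in e | adj E′ x y in e′
    ... | true | true = refl
    ... | false | false = refl
    ... | true | false = trans (sym (half {S} {E} {E′} sub f≗f′ im iso iso′ x y e)) e′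
    ... | false | true = trans (sym e) (half {S′} {E′} {E} sub′ (sym ∘ f≗f′) im′ iso′ iso x y e′)

module _ (f : Fin h → Fin n) where

  private
    preimage? : ∀ x → Dec (∃[ u ] f u ≡ x)
    preimage? x = Fin.any? (λ u → f u Fin.≟ x)

  image : Subset n
  image = ⟦ preimage? ⟧

  ∈-image⁺ : ∀ u → f u ∈ image
  ∈-image⁺ u = ∈⟦⟧⁺ preimage? (u , refl)

  ∈-image⁻ : ∀ {x} → x ∈ image → ∃[ u ] f u ≡ x
  ∈-image⁻ = ∈⟦⟧⁻ preimage?

module _ {H : Graph h} {G : Graph n} (f : Fin h → Fin n) where

  private
    edge? : ∀ x y → Dec (∃[ u ] ∃[ v ] f u ≡ x × f v ≡ y × Adj H u v)
    edge? x y = Fin.any? λ u → Fin.any? λ v →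
      (f u Fin.≟ x) ×-dec (f v Fin.≟ y) ×-dec (adj H u v Bool.≟ true)

  imageGraph : IsEmbedding H G f → Graph n
  imageGraph (inj , hom) = record
    { adj = λ x y → does (edge? x y)
    ; adj-sym = λ x y → does-⇔ (mk⇔ flip-edge flip-edge) (edge? x y) (edge? y x)
    ; adj-irrefl = λ x → dec-false (edge? x x) λ { (u , v , refl , eq , uv) →
        case trans (sym uv) (trans (cong (adj H u) (inj eq)) (adj-irrefl H u)) of λ () }
    }
    where
    flip-edge : ∀ {x y} → (∃[ u ] ∃[ v ] f u ≡ x × f v ≡ y × Adj H u v) →
      ∃[ u ] ∃[ v ] f u ≡ y × f v ≡ x × Adj H u v
    flip-edge (u , v , p , q , uv) = v , u , q , p , Adj-sym H uv

  -- The edge set is taken from the list graphs n, so that the copy is one of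
  -- those that are counted.
  imageCopy : IsEmbedding H G f → ∃[ E ] E ∈ˡ graphs n × IsCopy H G (image f , E)
  imageCopy emb@(inj , hom) with ∈-graphs (imageGraph emb)
  ... | E , E∈ , same = E , E∈ , sub , f , inj , onto , iso
    where
    sub : (image f , E) IsSubgraphOf G
    sub x y xy with edge? x y | trans (same x y) xy
    ... | yes (u , v , refl , refl , uv) | _ = ∈-image⁺ f u , ∈-image⁺ f v , hom uv
    onto : ∀ x → x ∈ image f ⇔ (∃[ u ] f u ≡ x)
    onto x = mk⇔ (∈-image⁻ f) (λ { (u , refl) → ∈-image⁺ f u })
    iso : ∀ u v → adj H u v ≡ adj E (f u) (f v)
    iso u v with edge? (f u) (f v) | same (f u) (f v)
    ... | yes (u′ , v′ , p , q , uv) | eq = trans (trans (cong₂ (adj H) (sym (inj p)) (sym (inj q))) uv) eq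
    ... | no ¬e | eq = trans (Bool.¬-not (λ uv → ¬e (u , v , refl , refl , uv))) eq

-- Freeness, edge counts and copy counts.

module _ (F : Family) where

  -- Together with `noEmbedding⇒free` this restates freeness through embeddings, which, unlike
  -- copies, can be composed.
  free⇒noEmbedding : ∀ {G : Graph n} → Free F G → ∀ {H : Graph h} → F (h , H) →
    ∀ {f} → ¬ IsEmbedding H G f
  free⇒noEmbedding {G = G} free {H} FH {f} emb with imageCopy {H = H} {G} f emb
  ... | E , _ , copy = free _ H FH ((image f , E) , copy)

  noEmbedding⇒free : ∀ {G : Graph n} →
    (∀ {h} {H : Graph h} → F (h , H) → ∀ {f} → ¬ IsEmbedding H G f) → Free F G
  noEmbedding⇒free {G = G} none h H FH (C , sub , iso) =
    none {H = H} FH (copyEmbedding {H = H} {G} C iso sub)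

  free-pullback : ∀ {G : Graph n} {G′ : Graph m} {φ : Fin m → Fin n} →
    IsEmbedding G′ G φ → Free F G → Free F G′
  free-pullback {G = G} {G′ = G′} (inj , hom) free = noEmbedding⇒free {G = G′}
    (λ {h} {H} FH {f} (f-inj , f-hom) → free⇒noEmbedding {G = G} free {H} FH (f-inj ∘ inj , hom ∘ f-hom))

≗ᴳ⇒embedding : ∀ {G G′ : Graph n} → G ≗ᴳ G′ → IsEmbedding G G′ id
≗ᴳ⇒embedding same = id , λ {u} {v} uv → trans (sym (same u v)) uv

-- Edges in both orientations, as the image of a vertex and its parent may come in either order.
arcs : Graph n → List (Fin n × Fin n)
arcs {n} G = filter (λ (x , y) → adj G x y Bool.≟ true) (cartesianProduct (allFin n) (allFin n))

∈-arcs : ∀ (G : Graph n) {x y} → Adj G x y → (x , y) ∈ˡ arcs G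
∈-arcs G xy = ∈-filter⁺ _ (∈-cartesianProduct⁺ (∈-allFin _) (∈-allFin _)) xy

length-arcs : (G : Graph n) → length (arcs G) ≤ 2 * edgeCount G
length-arcs {n} G = subst (length (arcs G) ≤_) total
  (length-≤-byInjection id id
    (Unique.filter⁺ (λ (x , y) → adj G x y Bool.≟ true)
      (Unique.cartesianProduct⁺ (Unique.allFin⁺ n) (Unique.allFin⁺ n)))
    covered)
  where
  swap′ : Fin n × Fin n → Fin n × Fin n
  swap′ (x , y) = y , x
  edges = filter (λ (x , y) → (x Fin.<? y) ×-dec (adj G x y Bool.≟ true))
                 (cartesianProduct (allFin n) (allFin n))
  both = edges ++ map swap′ edges
  total : length both ≡ 2 * edgeCount G
  total = trans (length-++ edges)
    (cong (length edges +_) (trans (length-map swap′ edges) (sym (+-identityʳ _))))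
  covered : ∀ {p} → p ∈ˡ arcs G → p ∈ˡ both
  covered {x , y} p∈
    with ∈-filter⁻ (λ (x , y) → adj G x y Bool.≟ true)
           {xs = cartesianProduct (allFin n) (allFin n)} p∈
  ... | _ , xy with <-cmp (toℕ x) (toℕ y)
  ... | tri< x<y _ _ = ∈-++⁺ˡ (∈-filter⁺ _ (∈-cartesianProduct⁺ (∈-allFin _) (∈-allFin _)) (x<y , xy))
  ... | tri> _ _ y<x = ∈-++⁺ʳ edges (∈-map⁺ swap′
      (∈-filter⁺ _ (∈-cartesianProduct⁺ (∈-allFin _) (∈-allFin _)) (y<x , Adj-sym G xy)))
  ... | tri≈ _ x≡y _ with Fin.toℕ-injective x≡y
  ... | refl = case trans (sym xy) (adj-irrefl G x) of λ ()

module _ (em : ExcludedMiddle 0ℓ) where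

  module _ (F : Family) (φ : Graph n → ℕ) where

    -- The bound is asked of every graph pointwise equal to `G`, because the list contains such a
    -- graph and perhaps not `G` itself.
    maxOverFree-≥ : {G : Graph n} → Free F G → ∀ {v} → (∀ {G′} → G ≗ᴳ G′ → v ≤ φ G′) →
      v ≤ maxOverFree em F n φ
    maxOverFree-≥ {G} free bound with ∈-graphs G
    ... | G′ , G′∈ , same = v≤max⁺ 0 _ (inj₂ (Any.map (λ { refl → bound same })
      (∈-map⁺ φ (∈-filter⁺ _ G′∈ (free-pullback F {G = G} {G′}
        (≗ᴳ⇒embedding {G = G′} {G} (λ x y → sym (same x y))) free)))))

    maxOverFree-≤ : ∀ {v} → (∀ {G : Graph n} → Free F G → φ G ≤ v) → maxOverFree em F n φ ≤ v
    maxOverFree-≤ bound = max≤v⁺ z≤n (All.tabulate λ y∈ →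
      let (G , G∈ , eq) = ∈-map⁻ φ y∈ in
      subst (_≤ _) (sym eq) (bound (proj₂ (∈-filter⁻ (λ G → em {Free F G}) {xs = graphs n} G∈))))

  module _ {t} (T : Graph t) (G : Graph n) where

    embeddings : List (Vec (Fin n) t)
    embeddings = filter (λ v → em {IsEmbedding T G (Vec.lookup v)}) (vecs (allFin n) t)

    copies : List (Candidate n)
    copies = filter (λ C → em {IsCopy T G C}) (cartesianProduct (subsets n) (graphs n))

    -- The isomorphism onto a copy is an embedding, and an embedding determines the copy by
    -- `copy-determined`.
    copyCount-≤ : copyCount em T G ≤ length embeddings
    copyCount-≤ = length-≤-byRelation {R = Onto} separated total
      where
      Onto : Candidate n → Vec (Fin n) t → Set
      Onto C@(S , E) v = IsCopy T G C × (∀ x → x ∈ S ⇔ (∃[ u ] Vec.lookup v u ≡ x))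
        × (∀ u w → adj T u w ≡ adj E (Vec.lookup v u) (Vec.lookup v w))
      distinct : AllPairs (λ (S , E) (S′ , E′) → ¬ (S ≡ S′ × E ≗ᴳ E′)) copies
      distinct = AllPairs.filter⁺ _
        (SetoidUnique.cartesianProduct⁺ (setoid (Subset n)) graphSetoid (subsets-unique n) (graphs-distinct n))
        where
        graphSetoid : Setoid 0ℓ 0ℓ
        graphSetoid = record
          { Carrier = Graph n ; _≈_ = _≗ᴳ_
          ; isEquivalence = record
            { refl = λ _ _ → refl ; sym = λ p x y → sym (p x y)
            ; trans = λ p q x y → trans (p x y) (q x y) } }
      separated : AllPairs (λ C C′ → ∀ v → Onto C v → ¬ Onto C′ v) copies
      separated = AllPairs.map (λ {(S , E)} {(S′ , E′)} C≉C′ v (c , im , iso) (c′ , im′ , iso′) →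
        C≉C′ (copy-determined {H = T} {G = G} {E = E} {E′ = E′} c c′ (λ _ → refl) im iso im′ iso′)) distinct
      total : ∀ {C} → C ∈ˡ copies → ∃[ v ] v ∈ˡ embeddings × Onto C v
      total {C} C∈ with ∈-filter⁻ (λ C → em {IsCopy T G C}) {xs = cartesianProduct (subsets n) (graphs n)} C∈
      ... | _ , c@(sub , iso@(f , inj , im , eq)) = Vec.tabulate f ,
        ∈-filter⁺ _ (∈-vecs _ (λ _ → ∈-allFin _))
          ( (λ {u} {w} e → inj (trans (sym (fv u)) (trans e (fv w))))
          , (λ {u} {w} uw → subst₂ (Adj G) (sym (fv u)) (sym (fv w))
              (proj₂ (copyEmbedding {H = T} {G} C iso sub) uw))) ,
        c , (λ x → mk⇔ (λ x∈ → let (u , p) = Equivalence.to (im x) x∈ in u , trans (fv u) p)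
                       (λ (u , p) → Equivalence.from (im x) (u , trans (sym (fv u)) p))) ,
        λ u w → trans (eq u w) (sym (cong₂ (adj (proj₂ C)) (fv u) (fv w)))
        where
        fv = Vec.lookup∘tabulate f

    -- Copies are told apart by their vertex sets alone, so it suffices that different labels give
    -- different images.
    copyCount-≥ : ∀ {L : Set} {ls : List L} → Unique ls → (f : L → Fin t → Fin n) →
      (∀ l → IsEmbedding T G (f l)) →
      (∀ {l l′} → (∀ x → (∃[ u ] f l u ≡ x) → ∃[ u ] f l′ u ≡ x) → l ≡ l′) →
      length ls ≤ copyCount em T G
    copyCount-≥ {L} {ls} u f emb inj = subst (length ls ≤_) (length-map proj₁ copies)
      (length-≤-byInjection (λ l → image (f l)) (λ eq → inj (λ { x (u , refl) →
          ∈-image⁻ _ (subst (f _ u ∈_) eq (∈-image⁺ _ u)) })) u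
        (λ {l} _ → let (E , E∈ , c) = imageCopy {H = T} {G} (f l) (emb l) in
          ∈-map⁺ proj₁ (∈-filter⁺ _ (∈-cartesianProduct⁺ (∈-subsets _) E∈) c)))

-- Sunflowers of copies.

-- s copies of T that are glued along U and otherwise disjoint.
record Sunflower (T : Graph t) (G : Graph n) (U : Subset t) (s : ℕ) : Set where
  field
    petal     : Fin s → Fin t → Fin n
    embedding : ∀ i → IsEmbedding T G (petal i)
    agree     : ∀ i j {x} → x ∈ U → petal i x ≡ petal j x
    disjoint  : ∀ {i j x y} → i ≢ j → petal i x ≡ petal j y → x ∈ U

  -- A value shared by two different petals comes from `x` in the kernel, where the petals agree;
  -- injectivity of one petal then applies.
  petal-cancel : ∀ {i j x y} → petal i x ≡ petal j y → x ≡ y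
  petal-cancel {i} {j} eq with i Fin.≟ j
  ... | yes refl = proj₁ (embedding i) eq
  ... | no i≢j = proj₁ (embedding j) (trans (agree j i (disjoint i≢j eq)) eq)

module _ {T : Graph t} {G : Graph n} {U : Subset t} where

  -- The `s` petals that are kept cover at most `s * t` vertices, so some `m` vertices of `G`
  -- contain them, and `G′` is the graph induced there.
  sunflower-pullback : ∀ {S s} → Sunflower T G U S → s ≤ S → s * t ≤ m → m ≤ n →
    Σ (Graph m) λ G′ → Sunflower T G′ U s × ∃[ φ ] IsEmbedding G′ G φ
  sunflower-pullback {m = m} {s = s} sun s≤S st≤m m≤n
    with injectionCovering points (subst (_≤ m) (sym |points|) st≤m) m≤n
    where
    open Sunflower sun
    points = cartesianProductWith (λ i → petal (inject≤ i s≤S)) (allFin s) (allFin t)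
    |points| : length points ≡ s * t
    |points| = trans (length-cartesianProductWith (λ i → petal (inject≤ i s≤S)) (allFin s) (allFin t))
      (cong₂ _*_ (length-allFin s) (length-allFin t))
  ... | φ , φ-inj , cover = G′ , record
    { petal = petal′
    ; embedding = λ i → (λ {x} {y} eq → petal-cancel (trans (sym (lifts i x)) (trans (cong φ eq) (lifts i y)))) ,
        λ {x} {y} xy → subst₂ (Adj G) (sym (lifts i x)) (sym (lifts i y)) (proj₂ (embedding (inject≤ i s≤S)) xy)
    ; agree = λ i j {x} x∈ → φ-inj (trans (lifts i x) (trans (agree _ _ x∈) (sym (lifts j x))))
    ; disjoint = λ {i} {j} {x} {y} i≢j eq → disjoint (i≢j ∘ Fin.inject≤-injective s≤S s≤S i j)
        (trans (sym (lifts i x)) (trans (cong φ eq) (lifts j y)))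
    } , φ , φ-inj , id
    where
    open Sunflower sun
    G′ : Graph m
    G′ = record
      { adj = λ x y → adj G (φ x) (φ y)
      ; adj-sym = λ x y → adj-sym G (φ x) (φ y)
      ; adj-irrefl = λ x → adj-irrefl G (φ x) }
    covered : ∀ (i : Fin s) x → ∃[ z ] φ z ≡ petal (inject≤ i s≤S) x
    covered i x = cover (∈-cartesianProductWith⁺ (λ i → petal (inject≤ i s≤S)) (∈-allFin i) (∈-allFin x))
    petal′ : Fin s → Fin t → Fin m
    petal′ i x = proj₁ (covered i x)
    lifts : ∀ i x → φ (petal′ i x) ≡ petal (inject≤ i s≤S) x
    lifts i x = proj₂ (covered i x)

  -- The components of T outside the kernel can be placed in the petals
  -- independently of each other.
  sunflower-copies : (em : ExcludedMiddle 0ℓ) (R : RootedOrder T) → ∀ {s} → Sunflower T G U s →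
    ∀ {ws} → Unique ws → All (Top R U) ws → 0 < length ws → s ^ length ws ≤ copyCount em T G
  sunflower-copies em R {s} sun {ws} u tops 0<ws =
    subst (_≤ copyCount em T G) (trans (length-vecs (allFin s) (length ws)) (cong (_^ length ws) (length-allFin s)))
      (copyCount-≥ em T G (vecs-unique (Unique.allFin⁺ s) (length ws)) place embeds distinct)
    where
    open Sunflower sun
    position : Fin t → Fin (length ws)
    position r with Any.any? (r Fin.≟_) ws
    ... | yes r∈ = Any.index r∈
    -- Vertices whose root is not in `ws` follow the first coordinate; on the kernel all petals
    -- agree, so the choice is free there.
    ... | no _ = fromℕ< 0<ws
    position-lookup : ∀ i → position (lookup ws i) ≡ i
    position-lookup i with Any.any? (lookup ws i Fin.≟_) ws
    ... | yes w∈ = sym (lookup-injective u (lookup-index w∈))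
    ... | no w∉ = contradiction (∈-lookup {xs = ws} i) w∉
    index : Fin t → Fin (length ws)
    index v = position (componentRoot R U v)
    index-top : ∀ i → index (lookup ws i) ≡ i
    index-top i = trans (cong position (componentRoot-top R U (All.lookup tops (∈-lookup {xs = ws} i))))
      (position-lookup i)
    place : Vec (Fin s) (length ws) → Fin t → Fin n
    place σ v = petal (Vec.lookup σ (index v)) v
    embeds : ∀ σ → IsEmbedding T G (place σ)
    embeds σ = petal-cancel , λ {x} {y} → hom x y
      where
      hom : ∀ x y → Adj T x y → Adj G (place σ x) (place σ y)
      hom x y xy with x ∈? U | y ∈? U
      ... | yes x∈ | _ = subst (λ z → Adj G z (place σ y)) (agree _ _ x∈) (proj₂ (embedding _) xy)
      ... | no _ | yes y∈ = subst (Adj G (place σ x)) (agree _ _ y∈) (proj₂ (embedding _) xy)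
      ... | no x∉ | no y∉ =
        subst (λ i → Adj G (place σ x) (petal (Vec.lookup σ i) y))
          (cong position (componentRoot-adj R U x∉ y∉ xy)) (proj₂ (embedding _) xy)
    distinct : ∀ {σ σ′} → (∀ x → (∃[ v ] place σ v ≡ x) → ∃[ v ] place σ′ v ≡ x) → σ ≡ σ′
    distinct {σ} {σ′} sub = lookup-ext same
      where
      same : ∀ i → Vec.lookup σ i ≡ Vec.lookup σ′ i
      -- By `petal-cancel` the image of the `i`-th top is attained under `σ′` at that top too. If
      -- the coordinates differed, disjointness would put the top into `U`.
      same i with sub _ (lookup ws i , refl)
      ... | v , eq with petal-cancel eq
      ... | refl with Vec.lookup σ i Fin.≟ Vec.lookup σ′ i
      ... | yes p = p
      ... | no σ≢ = contradiction
        (disjoint (σ≢ ∘ sym) (subst (λ j → petal (Vec.lookup σ′ j) v ≡ petal (Vec.lookup σ j) v) (index-top i) eq))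
        (proj₁ (All.lookup tops (∈-lookup {xs = ws} i)))

-- The delta-system method.

_≟ˢ_ : DecidableEquality (Subset t)
_≟ˢ_ = Vec.≡-dec Bool._≟_

-- Accounts for a thinned class of size `a` joining one part. It is an inequality because `y` may
-- occur several times in `xs`.
sum-bumped : ∀ {a} {f g : A → ℕ} → (∀ x → f x ≤ g x) → ∀ {y} → a + f y ≤ g y →
  ∀ {xs} → y ∈ˡ xs → a + sum (map f xs) ≤ sum (map g xs)
sum-bumped {A = A} {a} {f} {g} f≤g bump {x ∷ xs} = go
  where
  mono : ∀ zs → sum (map f zs) ≤ sum (map g zs)
  mono [] = z≤n
  mono (z ∷ zs) = +-mono-≤ (f≤g z) (mono zs)
  go : ∀ {x xs} → _ ∈ˡ x ∷ xs → a + (f x + sum (map f xs)) ≤ g x + sum (map g xs)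
  go {x} {xs} (here refl) = subst (_≤ g x + sum (map g xs)) (+-assoc a (f x) _) (+-mono-≤ bump (mono xs))
  go {x} {z ∷ zs} (there y∈) = begin
    a + (f x + s) ≡⟨ +-assoc a (f x) s ⟨
    a + f x + s   ≡⟨ cong (_+ s) (+-comm a (f x)) ⟩
    f x + a + s   ≡⟨ +-assoc (f x) a s ⟩
    f x + (a + s) ≤⟨ +-mono-≤ (f≤g x) (go y∈) ⟩
    g x + sum (map g (z ∷ zs)) ∎
    where
    open ≤-Reasoning
    s = sum (map f (z ∷ zs))

sum-≤ : ∀ {f : A → ℕ} {c} xs → (∀ {x} → x ∈ˡ xs → f x ≤ c) → sum (map f xs) ≤ length xs * c
sum-≤ [] h = z≤n
sum-≤ (x ∷ xs) h = +-mono-≤ (h (here refl)) (sum-≤ xs (h ∘ there))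

∈⇒0<length : ∀ {x : A} {xs} → x ∈ˡ xs → 0 < length xs
∈⇒0<length (here _) = z<s
∈⇒0<length (there _) = z<s

agreement : Vec (Fin n) t → Vec (Fin n) t → Subset t
agreement f g = ⟦ (λ x → Vec.lookup f x Fin.≟ Vec.lookup g x) ⟧

module _ (f g : Vec (Fin n) t) where

  ∈-agreement⁺ : ∀ {x} → Vec.lookup f x ≡ Vec.lookup g x → x ∈ agreement f g
  ∈-agreement⁺ = ∈⟦⟧⁺ (λ x → Vec.lookup f x Fin.≟ Vec.lookup g x)

  ∈-agreement⁻ : ∀ {x} → x ∈ agreement f g → Vec.lookup f x ≡ Vec.lookup g x
  ∈-agreement⁻ = ∈⟦⟧⁻ (λ x → Vec.lookup f x Fin.≟ Vec.lookup g x)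

  agreement-proper : f ≢ g → ∃[ x ] x ∉ agreement f g
  agreement-proper f≢g with Fin.any? (λ x → ¬? (x ∈? agreement f g))
  ... | yes p = p
  ... | no none = contradiction
    (lookup-ext (λ x → ∈-agreement⁻ (decidable-stable (x ∈? agreement f g) (λ x∉ → none (x , x∉))))) f≢g

Proper : Subset t → Set
Proper U = ∃[ x ] x ∉ U

AgreementsIn : List (Subset t) → List (Vec (Fin n) t) → Set
AgreementsIn J fs = ∀ {f g} → f ∈ˡ fs → g ∈ˡ fs → f ≢ g → agreement f g ∈ˡ J

-- Bounds the number of pairs (x , q y) with q in a family of at most S vectors.
loss : ℕ → ℕ → ℕ
loss t S = t * (S * t)

module _ (em : ExcludedMiddle 0ℓ) {t n : ℕ} (S : ℕ) where

  InjectiveVec : Vec (Fin n) t → Set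
  InjectiveVec f = Injective _≡_ _≡_ (Vec.lookup f)

  -- The petals come from `fs` and share the values of `f` on `U`; `f` need not be a petal.
  record SunflowerAt (fs : List (Vec (Fin n) t)) (U : Subset t) (f : Vec (Fin n) t) : Set where
    field
      member   : Fin S → Vec (Fin n) t
      member∈  : ∀ i → member i ∈ˡ fs
      agrees   : ∀ i {x} → x ∈ U → Vec.lookup (member i) x ≡ Vec.lookup f x
      disjoint : ∀ {i j} → i ≢ j → ∀ {x y} →
        Vec.lookup (member i) x ≡ Vec.lookup (member j) y → x ∈ U

  Collide : Subset t → Vec (Fin n) t → Vec (Fin n) t → Set
  Collide U f g = ∃[ x ] ∃[ y ] x ∉ U × y ∉ U × Vec.lookup f x ≡ Vec.lookup g y

  -- Greedy choice. A vertex outside `U` makes each chosen vector collide with itself, so the chosen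
  -- ones are covered as well.
  maximalDisjoint : ∀ {U} → Proper U → ∀ K → ∃[ Q ] (∀ {q} → q ∈ˡ Q → q ∈ˡ K)
    × AllPairs (λ f g → ¬ Collide U f g) Q × (∀ {f} → f ∈ˡ K → ∃[ q ] q ∈ˡ Q × Collide U f q)
  maximalDisjoint _ [] = [] , id , [] , λ ()
  maximalDisjoint {U} proper@(x , x∉) (f ∷ K) with maximalDisjoint proper K
  ... | Q , Q⊆ , dis , hit with em {∃[ q ] q ∈ˡ Q × Collide U f q}
  ... | yes c = Q , there ∘ Q⊆ , dis , λ { (here refl) → c ; (there g∈) → hit g∈ }
  ... | no ¬c = f ∷ Q , (λ { (here p) → here p ; (there q∈) → there (Q⊆ q∈) }) ,
    All.tabulate (λ q∈ c → ¬c (_ , q∈ , c)) ∷ dis ,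
    λ { (here refl) → f , here refl , x , x , x∉ , x∉ , refl
      ; (there g∈) → let (q , q∈ , c) = hit g∈ in q , there q∈ , c }

  Avoids : Subset t → List (Vec (Fin n) t) → Set
  Avoids U fs = ∀ {f g} → f ∈ˡ fs → g ∈ˡ fs → f ≢ g → agreement f g ≢ U

  -- Without a sunflower, a maximal disjoint subfamily `Q` has fewer than `S` members, and every
  -- member of `K` takes a value of `Q` somewhere outside `U`. By pigeonhole many members share one
  -- value at one vertex outside `U`, and none of their agreements is `U`.
  thinClass : ∀ {fs U f K} → Proper U → ¬ SunflowerAt fs U f → f ∈ˡ K →
    (∀ {g} → g ∈ˡ K → g ∈ˡ fs × InjectiveVec g × (∀ {x} → x ∈ U → Vec.lookup g x ≡ Vec.lookup f x)) →
    Unique K → ∃[ K′ ] (∀ {g} → g ∈ˡ K′ → g ∈ˡ K) × Unique K′ × Avoids U K′ × length K ≤ loss t S * length K′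
  thinClass {fs} {U} {f} {K} proper@(x₀ , x₀∉) none f∈K class u with maximalDisjoint proper K
  ... | Q , Q⊆ , dis , hit = K′ , proj₁ ∘ ∈-filter⁻ _ , Unique.filter⁺ _ u , avoids ,
    ≤-trans bound (*-monoˡ-≤ (length K′) points≤)
    where
    ¬S≤Q : ¬ S ≤ length Q
    ¬S≤Q S≤Q = none (record
      { member = q
      ; member∈ = λ i → proj₁ (class (q∈K i))
      ; agrees = λ i → proj₂ (proj₂ (class (q∈K i)))
      ; disjoint = λ {i} {j} i≢j {x} {y} eq → decidable-stable (x ∈? U) (λ x∉ →
          lookup-allPairs (λ { ¬c (a , b , a∉ , b∉ , e) → ¬c (b , a , b∉ , a∉ , sym e) }) dis
            (inject≤ i S≤Q) (inject≤ j S≤Q) (i≢j ∘ Fin.inject≤-injective S≤Q S≤Q i j)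
            (x , y , x∉ , outside {i} {j} x∉ eq , eq)) })
      where
      q : Fin S → Vec (Fin n) t
      q i = lookup Q (inject≤ i S≤Q)
      q∈K : ∀ i → q i ∈ˡ K
      q∈K i = Q⊆ (∈-lookup {xs = Q} (inject≤ i S≤Q))
      outside : ∀ {i j x y} → x ∉ U → Vec.lookup (q i) x ≡ Vec.lookup (q j) y → y ∉ U
      -- If `y` were in `U`, both petals would have the value of `f` at `y`, and injectivity would
      -- give `x ≡ y`.
      outside {i} {j} {x} {y} x∉ eq y∈ = x∉ (subst (_∈ U) (sym x≡y) y∈)
        where
        x≡y : x ≡ y
        x≡y = proj₁ (proj₂ (class (q∈K i))) (trans eq (trans (proj₂ (proj₂ (class (q∈K j))) y∈)
          (sym (proj₂ (proj₂ (class (q∈K i))) y∈))))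
    values = cartesianProductWith Vec.lookup Q (allFin t)
    points = cartesianProduct (allFin t) values
    points≤ : length points ≤ loss t S
    points≤ = subst (_≤ loss t S) (sym (trans (length-cartesianProductWith _,_ (allFin t) values)
        (cong₂ _*_ (length-allFin t) (trans (length-cartesianProductWith Vec.lookup Q (allFin t))
          (cong (length Q *_) (length-allFin t))))))
      (*-monoʳ-≤ t (*-monoˡ-≤ t (<⇒≤ (≰⇒> ¬S≤Q))))
    through? : ∀ g (p : Fin t × Fin n) → Dec (proj₁ p ∉ U × Vec.lookup g (proj₁ p) ≡ proj₂ p)
    through? g (x , z) = ¬? (x ∈? U) ×-dec (Vec.lookup g x Fin.≟ z)
    popular = popularLabel through? (x₀ , Vec.lookup f x₀) K points λ {g} g∈ →
      let (q , q∈ , x , y , x∉ , y∉ , eq) = hit g∈ in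
      (x , Vec.lookup q y) ,
      ∈-cartesianProduct⁺ (∈-allFin x) (∈-cartesianProductWith⁺ Vec.lookup q∈ (∈-allFin y)) , x∉ , eq
    p = proj₁ popular
    bound = proj₂ popular
    K′ = filter (λ g → through? g p) K
    avoids : Avoids U K′
    avoids {g} {h} g∈ h∈ _ agr with ∈-filter⁻ (λ g → through? g p) {xs = K} g∈
                             | ∈-filter⁻ (λ g → through? g p) {xs = K} h∈
    ... | _ , x∉ , e | _ , _ , e′ = x∉ (subst (proj₁ p ∈_) agr (∈-agreement⁺ g h (trans e (sym e′))))

  -- A homogeneous family `good` and, for each `U`, a part in which `U` no longer occurs as an
  -- agreement; up to the factor `loss t S` they account for all of `fs`.
  record Split (J : List (Subset t)) (fs : List (Vec (Fin n) t)) : Set where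
    field
      good        : List (Vec (Fin n) t)
      good⊆       : ∀ {f} → f ∈ˡ good → f ∈ˡ fs
      good-unique : Unique good
      sunflowers  : ∀ {U f} → U ∈ˡ J → f ∈ˡ good → SunflowerAt good U f
      part        : Subset t → List (Vec (Fin n) t)
      part⊆       : ∀ U {f} → f ∈ˡ part U → f ∈ˡ fs
      part-unique : ∀ U → Unique (part U)
      part-avoids : ∀ U → Avoids U (part U)
      bound       : length fs ≤ length good + loss t S * sum (map (length ∘ part) J)

  -- As long as some `U` and `f` have no sunflower, the whole class of vectors agreeing with `f` on
  -- `U` is removed, thinned and put into the part of `U`. The class contains `f`, so the list
  -- shrinks; what remains at the end is `good`.
  split : ∀ {J} → (∀ {U} → U ∈ˡ J → Proper U) → ∀ j fs → length fs ≤ j → Unique fs →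
    (∀ {f} → f ∈ˡ fs → InjectiveVec f) → Split J fs
  split {J} proper j fs fs≤j u inj with em {∃[ U ] ∃[ f ] U ∈ˡ J × f ∈ˡ fs × ¬ SunflowerAt fs U f}
  ... | no none = record
    { good = fs ; good⊆ = id ; good-unique = u
    ; sunflowers = λ {U} {f} U∈ f∈ → decidable-stable em (λ ¬s → none (U , f , U∈ , f∈ , ¬s))
    ; part = λ _ → [] ; part⊆ = λ _ () ; part-unique = λ _ → [] ; part-avoids = λ _ ()
    ; bound = m≤m+n _ _ }
  split proper zero [] _ _ _ | yes (_ , _ , _ , () , _)
  split {J} proper (suc j) fs fs≤j u inj | yes (U , f , U∈ , f∈ , none) = record
    { good = R.good
    ; good⊆ = proj₁ ∘ rest⁻ ∘ R.good⊆
    ; good-unique = R.good-unique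
    ; sunflowers = R.sunflowers
    ; part = part
    ; part⊆ = proj₁ ∘ parts
    ; part-unique = proj₁ ∘ proj₂ ∘ parts
    ; part-avoids = proj₂ ∘ proj₂ ∘ parts
    ; bound = begin
        length fs ≡⟨ length-filter-split agrees? fs ⟩
        length K + length rest ≤⟨ +-mono-≤ K-bound R.bound ⟩
        loss t S * length K′ + (length R.good + loss t S * Σpart R.part)
          ≡⟨ rearrange (loss t S * length K′) (length R.good) _ ⟩
        length R.good + (loss t S * length K′ + loss t S * Σpart R.part)
          ≡⟨ cong (length R.good +_) (*-distribˡ-+ (loss t S) (length K′) _) ⟨
        length R.good + loss t S * (length K′ + Σpart R.part)
          ≤⟨ +-monoʳ-≤ (length R.good) (*-monoʳ-≤ (loss t S) (sum-bumped grows (≤-reflexive bump) U∈)) ⟩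
        length R.good + loss t S * Σpart part ∎
    }
    where
    open ≤-Reasoning
    rearrange : ∀ a b c → a + (b + c) ≡ b + (a + c)
    rearrange a b c = trans (sym (+-assoc a b c)) (trans (cong (_+ c) (+-comm a b)) (+-assoc b a c))
    agrees? : ∀ g → Dec (∀ {x} → x ∈ U → Vec.lookup g x ≡ Vec.lookup f x)
    agrees? g = em
    K = filter agrees? fs
    rest = filter (¬? ∘ agrees?) fs
    K⁻ : ∀ {g} → g ∈ˡ K → g ∈ˡ fs × (∀ {x} → x ∈ U → Vec.lookup g x ≡ Vec.lookup f x)
    K⁻ = ∈-filter⁻ agrees? {xs = fs}
    rest⁻ : ∀ {g} → g ∈ˡ rest → g ∈ˡ fs × ¬ (∀ {x} → x ∈ U → Vec.lookup g x ≡ Vec.lookup f x)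
    rest⁻ = ∈-filter⁻ (¬? ∘ agrees?) {xs = fs}
    f∈K : f ∈ˡ K
    f∈K = ∈-filter⁺ agrees? f∈ (λ _ → refl)
    shorter : length rest ≤ j
    shorter = s≤s⁻¹ (≤-trans (+-monoˡ-≤ (length rest) (∈⇒0<length f∈K))
      (subst (_≤ suc j) (length-filter-split agrees? fs) fs≤j))
    module R = Split (split {J} proper j rest shorter (Unique.filter⁺ _ u) (inj ∘ proj₁ ∘ rest⁻))
    thin = thinClass {fs} (proper U∈) none f∈K
      (λ g∈ → let (g∈fs , ag) = K⁻ g∈ in g∈fs , inj g∈fs , ag) (Unique.filter⁺ _ u)
    K′ = proj₁ thin
    K′⊆ : ∀ {g} → g ∈ˡ K′ → g ∈ˡ K
    K′⊆ = proj₁ (proj₂ thin)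
    K-bound = proj₂ (proj₂ (proj₂ (proj₂ thin)))
    part = override _≟ˢ_ U (K′ ++ R.part U) R.part
    Σpart : (Subset t → List (Vec (Fin n) t)) → ℕ
    Σpart q = sum (map (length ∘ q) J)
    part-U : part U ≡ K′ ++ R.part U
    part-U = override-at _≟ˢ_ U _ R.part
    bump : length K′ + length (R.part U) ≡ length (part U)
    bump = sym (trans (cong length part-U) (length-++ K′))
    grows : ∀ V → length (R.part V) ≤ length (part V)
    grows V with V ≟ˢ U
    ... | yes refl = subst (length (R.part V) ≤_) (sym (length-++ K′)) (m≤n+m _ (length K′))
    ... | no _ = ≤-refl
    -- Vectors from different classes differ somewhere on `U`, so merging classes creates no
    -- agreement equal to `U`.
    cross : ∀ {g h} → g ∈ˡ K′ → h ∈ˡ R.part U → ¬ (∀ {x} → x ∈ U → Vec.lookup g x ≡ Vec.lookup h x)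
    cross g∈ h∈ same = proj₂ (rest⁻ (R.part⊆ U h∈)) (λ x∈ →
      trans (sym (same x∈)) (proj₂ (K⁻ (K′⊆ g∈)) x∈))
    merged-avoids : Avoids U (K′ ++ R.part U)
    merged-avoids {g} {h} g∈ h∈ g≢h agr with ∈-++⁻ K′ g∈ | ∈-++⁻ K′ h∈
    ... | inj₁ g∈ | inj₁ h∈ = proj₁ (proj₂ (proj₂ (proj₂ thin))) g∈ h∈ g≢h agr
    ... | inj₂ g∈ | inj₂ h∈ = R.part-avoids U g∈ h∈ g≢h agr
    ... | inj₁ g∈ | inj₂ h∈ = cross g∈ h∈ (λ {x} x∈ → ∈-agreement⁻ g h (subst (x ∈_) (sym agr) x∈))
    ... | inj₂ g∈ | inj₁ h∈ = cross h∈ g∈ (λ {x} x∈ → sym (∈-agreement⁻ g h (subst (x ∈_) (sym agr) x∈)))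
    parts : ∀ V → (∀ {g} → g ∈ˡ part V → g ∈ˡ fs) × Unique (part V) × Avoids V (part V)
    parts V with V ≟ˢ U
    ... | no _ = proj₁ ∘ rest⁻ ∘ R.part⊆ V , R.part-unique V , R.part-avoids V
    ... | yes refl =
      [ proj₁ ∘ K⁻ ∘ K′⊆ , proj₁ ∘ rest⁻ ∘ R.part⊆ U ]′ ∘ ∈-++⁻ K′ ,
      Unique.++⁺ (proj₁ (proj₂ (proj₂ thin))) (R.part-unique U)
        (λ { (g∈ , h∈) → cross g∈ h∈ (λ _ → refl) }) ,
      merged-avoids

-- Counting embeddings through homogeneous families.

-- The summand 1 pays for the homogeneous family, the other one for at most `suc ℓ` parts, each with
-- one possible agreement fewer.
factor : (t S ℓ : ℕ) → ℕ
factor t S zero = 1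
factor t S (suc ℓ) = 1 + loss t S * (suc ℓ * factor t S ℓ)

module _ (em : ExcludedMiddle 0ℓ) {t n : ℕ} {T : Graph t} (R : RootedOrder T) (G : Graph n)
         (root : Fin t) (S : ℕ) (t<S : t < S) (k : ℕ)
         (fewTops : ∀ {U} → Sunflower T G U S → ∀ {vs} → Unique vs → All (Top R U) vs → length vs < suc k)
         where
  open RootedOrder R

  private
    Emb : Vec (Fin n) t → Set
    Emb f = IsEmbedding T G (Vec.lookup f)

  module _ {J : List (Subset t)} (proper : ∀ {U} → U ∈ˡ J → Proper U) {fs : List (Vec (Fin n) t)}
           (emb : ∀ {f} → f ∈ˡ fs → Emb f) (agrs : AgreementsIn J fs)
           (sunflowers : ∀ {U f} → U ∈ˡ J → f ∈ˡ fs → SunflowerAt em S fs U f) where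

    -- Two petals with kernel `U` each carry a sunflower with kernel `V`. A petal `a` of the first
    -- and a suitable petal of the second agree only inside `V`, where they copy the two `U`-petals
    -- and so agree exactly on `U`.
    kernels-∩-closed : ∀ {f} → f ∈ˡ fs → ∀ {U V} → U ∈ˡ J → V ∈ˡ J → U ∩ V ∈ˡ J
    kernels-∩-closed {f} f∈ {U} {V} U∈ V∈ = subst (_∈ˡ J) meet
      (agrs (A.member∈ i₀) (B.member∈ j) λ a≡b →
        let (x , x∉) = proper U∈ in
        x∉ (proj₁ (x∈p∩q⁻ U V (subst (x ∈_) meet
          (∈-agreement⁺ a (B.member j) (cong (λ v → Vec.lookup v x) a≡b))))))
      where
      module F = SunflowerAt (sunflowers U∈ f∈)
      1<S : 1 < S
      1<S = <-≤-trans (s≤s (≤-<-trans z≤n (Fin.toℕ<n root))) t<S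
      i₀ i₁ : Fin S
      i₀ = fromℕ< (<-trans z<s 1<S)
      i₁ = fromℕ< 1<S
      i₀≢i₁ : i₀ ≢ i₁
      i₀≢i₁ eq = contradiction (trans (sym (Fin.toℕ-fromℕ< _)) (trans (cong toℕ eq) (Fin.toℕ-fromℕ< _))) λ ()
      module A = SunflowerAt (sunflowers V∈ (F.member∈ i₀))
      module B = SunflowerAt (sunflowers V∈ (F.member∈ i₁))
      a = A.member i₀
      Bad : Fin S → Set
      Bad j = ∃[ x ] x ∉ V × Vec.lookup a x ≡ Vec.lookup (B.member j) x
      bad? : ∀ j → Dec (Bad j)
      bad? j = Fin.any? λ x → ¬? (x ∈? V) ×-dec (Vec.lookup a x Fin.≟ Vec.lookup (B.member j) x)
      -- Two petals meeting `a` at the same vertex outside `V` would meet each other there; as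
      -- `t < S`, some petal escapes.
      notAllBad : ¬ (∀ j → Bad j)
      notAllBad bad with Fin.pigeonhole t<S (proj₁ ∘ bad)
      ... | i , j , i<j , eq = proj₁ (proj₂ (bad i)) (B.disjoint {i} {j} (Fin.<⇒≢ i<j)
        (trans (sym (proj₂ (proj₂ (bad i))))
          (trans (cong (Vec.lookup a) eq) (proj₂ (proj₂ (bad j))))))
      good : ∃[ j ] ¬ Bad j
      good = Fin.¬∀⟶∃¬ S Bad bad? notAllBad
      j = proj₁ good
      meet : agreement a (B.member j) ≡ U ∩ V
      meet = ⊆-antisym
        (λ {x} x∈ →
          let eq = ∈-agreement⁻ a (B.member j) x∈
              x∈V = decidable-stable (x ∈? V) (λ x∉ → proj₂ good (x , x∉ , eq)) in
          x∈p∩q⁺ (F.disjoint i₀≢i₁ (trans (sym (A.agrees i₀ x∈V)) (trans eq (B.agrees j x∈V))) , x∈V))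
        (λ {x} x∈ →
          let (x∈U , x∈V) = x∈p∩q⁻ U V x∈ in
          ∈-agreement⁺ a (B.member j) (trans (A.agrees i₀ x∈V) (trans (F.agrees i₀ x∈U)
            (trans (sym (F.agrees i₁ x∈U)) (sym (B.agrees j x∈V))))))

    -- By the hitting lemma a member is determined by the images of at most k
    -- edges of T.
    length-homogeneous-≤ : Unique fs → length fs ≤ length (arcs G) ^ k
    length-homogeneous-≤ u with em {∃[ f ] f ∈ˡ fs}
    ... | no none = subst (_≤ length (arcs G) ^ k) (sym (empty fs (λ f∈ → none (_ , f∈)))) z≤n
      where
      empty : ∀ (xs : List (Vec (Fin n) t)) → (∀ {x} → ¬ x ∈ˡ xs) → length xs ≡ 0
      empty [] _ = refl
      empty (x ∷ xs) h = contradiction (here refl) h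
    ... | yes (f₀ , f₀∈) = ≤-trans
      (length-≤-byRelation {R = λ f c → f ∈ˡ fs × code f ≡ c} separated
        (λ {f} f∈ → code f , ∈-vecs (code f) (λ i → subst (_∈ˡ arcs G) (sym (code-lookup f i))
            (∈-arcs G (proj₂ (emb f∈) (parent-adj (lookup vs i))))) , f∈ , refl))
      (subst (_≤ length (arcs G) ^ k) (sym (length-vecs (arcs G) (length vs)))
        (^-monoʳ-≤ (length (arcs G)) {{>-nonZero 0<arcs}} (s≤s⁻¹ (proj₁ (proj₂ edges)))))
      where
      edges = hittingEdges R em (_∈ˡ J) proper (kernels-∩-closed f₀∈) {suc k} z<s
        (λ {U} U∈ → fewTops (record
          { petal = λ i → Vec.lookup (SunflowerAt.member (sunflowers U∈ f₀∈) i)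
          ; embedding = λ i → emb (SunflowerAt.member∈ (sunflowers U∈ f₀∈) i)
          ; agree = λ i j x∈ → trans (SunflowerAt.agrees (sunflowers U∈ f₀∈) i x∈)
              (sym (SunflowerAt.agrees (sunflowers U∈ f₀∈) j x∈))
          ; disjoint = λ i≢j → SunflowerAt.disjoint (sunflowers U∈ f₀∈) i≢j }))
      vs = proj₁ edges
      arc : Vec (Fin n) t → Fin (length vs) → Fin n × Fin n
      arc f i = Vec.lookup f (lookup vs i) , Vec.lookup f (parent (lookup vs i))
      code : Vec (Fin n) t → Vec (Fin n × Fin n) (length vs)
      code f = Vec.tabulate (arc f)
      code-lookup : ∀ f i → Vec.lookup (code f) i ≡ arc f i
      code-lookup f = Vec.lookup∘tabulate (arc f)
      -- The exponent can be raised from `length vs` to `k` because the embedding `f₀` makes the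
      -- base positive.
      0<arcs : 0 < length (arcs G)
      0<arcs = ∈⇒0<length (∈-arcs G (proj₂ (emb f₀∈) (parent-adj root)))
      -- Equal codes would put all chosen edges into the agreement of `f` and `g`, a member of `J`,
      -- which some chosen edge must leave.
      separated : AllPairs (λ f g → ∀ c → f ∈ˡ fs × code f ≡ c → ¬ (g ∈ˡ fs × code g ≡ c)) fs
      separated = AllPairs.map (λ {f} {g} f≢g c (f∈ , p) (g∈ , q) →
        proj₂ (proj₂ edges) (agrs f∈ g∈ f≢g) (All.tabulate (same f g (trans p (sym q))))) u
        where
        same : ∀ f g → code f ≡ code g → ∀ {v} → v ∈ˡ vs →
          v ∈ agreement f g × parent v ∈ agreement f g
        same f g eq {v} v∈ = ∈-agreement⁺ f g (cong proj₁ arc≡) , ∈-agreement⁺ f g (cong proj₂ arc≡)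
          where
          arcAt : Vec (Fin n) t → Fin t → Fin n × Fin n
          arcAt f v = Vec.lookup f v , Vec.lookup f (parent v)
          arc≡ : arcAt f v ≡ arcAt g v
          arc≡ = subst (λ w → arcAt f w ≡ arcAt g w) (sym (lookup-index v∈))
            (trans (sym (code-lookup f (Any.index v∈)))
              (trans (cong (λ c → Vec.lookup c (Any.index v∈)) eq) (code-lookup g (Any.index v∈))))

  -- Induction on the number of possible agreements: `good` is homogeneous, and the part of `U` has
  -- its agreements in `J` without `U`.
  length-embeddings-≤ : ∀ ℓ {J} → length J ≤ ℓ → (∀ {U} → U ∈ˡ J → Proper U) → ∀ {fs} → Unique fs →
    (∀ {f} → f ∈ˡ fs → Emb f) → AgreementsIn J fs → length fs ≤ factor t S ℓ * length (arcs G) ^ k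
  length-embeddings-≤ ℓ {J} J≤ℓ proper {fs} u emb agrs = ≤-trans bound (finish ℓ J≤ℓ)
    where
    open Split (split em S {J} proper (length fs) fs ≤-refl u (λ f∈ → proj₁ (emb f∈)))
    L = loss t S
    E = length (arcs G) ^ k
    good≤ : length good ≤ E
    good≤ = length-homogeneous-≤ proper (emb ∘ good⊆)
      (λ f∈ g∈ → agrs (good⊆ f∈) (good⊆ g∈)) sunflowers good-unique
    part≤ : ∀ ℓ′ → length J ≤ suc ℓ′ → ∀ {U} → U ∈ˡ J → length (part U) ≤ factor t S ℓ′ * E
    part≤ ℓ′ J≤ {U} U∈ = length-embeddings-≤ ℓ′ {filter (λ V → ¬? (V ≟ˢ U)) J}
      (s≤s⁻¹ (≤-trans (filter-notAll (λ V → ¬? (V ≟ˢ U)) J (Any.map (λ { refl ¬p → ¬p refl }) U∈)) J≤))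
      (proper ∘ proj₁ ∘ ∈-filter⁻ _)
      (part-unique U) (emb ∘ part⊆ U)
      (λ f∈ g∈ f≢g → ∈-filter⁺ _ (agrs (part⊆ U f∈) (part⊆ U g∈) f≢g) (part-avoids U f∈ g∈ f≢g))
    finish : ∀ ℓ → length J ≤ ℓ → length good + L * sum (map (length ∘ part) J) ≤ factor t S ℓ * E
    finish zero J≤ = +-mono-≤ good≤ (≤-reflexive (trans (cong (λ j → L * j) (noParts J J≤)) (*-zeroʳ L)))
      where
      noParts : ∀ J → length J ≤ 0 → sum (map (length ∘ part) J) ≡ 0
      noParts [] _ = refl
    finish (suc ℓ) J≤ = +-mono-≤ good≤ (begin
      L * sum (map (length ∘ part) J) ≤⟨ *-monoʳ-≤ L (sum-≤ J (part≤ ℓ J≤)) ⟩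
      L * (length J * (factor t S ℓ * E)) ≤⟨ *-monoʳ-≤ L (*-monoˡ-≤ (factor t S ℓ * E) J≤) ⟩
      L * (suc ℓ * (factor t S ℓ * E))    ≡⟨ cong (L *_) (*-assoc (suc ℓ) (factor t S ℓ) E) ⟨
      L * (suc ℓ * factor t S ℓ * E)      ≡⟨ *-assoc L (suc ℓ * factor t S ℓ) E ⟨
      L * (suc ℓ * factor t S ℓ) * E      ∎)
      where open ≤-Reasoning

-- The dichotomy.

sunflower-map : ∀ {t} {T : Graph t} {U s} {G : Graph m} {G′ : Graph n} {φ} → IsEmbedding G G′ φ →
  Sunflower T G U s → Sunflower T G′ U s
sunflower-map {φ = φ} (φ-inj , φ-hom) sun = record
  { petal = λ i → φ ∘ petal i
  ; embedding = λ i → proj₁ (embedding i) ∘ φ-inj , φ-hom ∘ proj₂ (embedding i)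
  ; agree = λ i j x∈ → cong φ (agree i j x∈)
  ; disjoint = λ i≢j → disjoint i≢j ∘ φ-inj
  }
  where open Sunflower sun

edgeCount-mono : ∀ {G G′ : Graph n} → G ≗ᴳ G′ → edgeCount G ≤ edgeCount G′
edgeCount-mono {n} {G} {G′} same = length-≤-byInjection id id
  (Unique.filter⁺ edge? (Unique.cartesianProduct⁺ (Unique.allFin⁺ n) (Unique.allFin⁺ n)))
  λ p∈ → let (p∈₀ , x<y , xy) = ∈-filter⁻ edge? {xs = cartesianProduct (allFin n) (allFin n)} p∈ in
    ∈-filter⁺ _ p∈₀ (x<y , trans (sym (same _ _)) xy)
  where
  edge? : ∀ (p : Fin n × Fin n) → Dec (proj₁ p Fin.< proj₂ p × Adj G (proj₁ p) (proj₂ p))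
  edge? (x , y) = (x Fin.<? y) ×-dec (adj G x y Bool.≟ true)

^-distribʳ-* : ∀ k a b → (a * b) ^ k ≡ a ^ k * b ^ k
^-distribʳ-* zero a b = refl
^-distribʳ-* (suc k) a b =
  trans (cong (a * b *_) (^-distribʳ-* k a b)) ([m*n]*[o*p]≡[m*o]*[n*p] a b (a ^ k) (b ^ k))

-- The remainder is below `t`, hence at most `n / t * t` once `t ≤ n`, so rounding down costs a
-- factor of at most two.
n≤2t[n/t] : ∀ n t .{{_ : NonZero t}} → t ≤ n → n ≤ 2 * t * (n / t)
n≤2t[n/t] n t t≤n = begin
  n                           ≡⟨ m≡m%n+[m/n]*n n t ⟩
  n % t + n / t * t           ≤⟨ +-monoˡ-≤ (n / t * t) (<⇒≤ (m%n<n n t)) ⟩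
  t + n / t * t               ≤⟨ +-monoˡ-≤ (n / t * t) (m≤n*m t (n / t) {{>-nonZero (m≥n⇒m/n>0 t≤n)}}) ⟩
  n / t * t + n / t * t       ≡⟨ cong (λ q → q + q) (*-comm (n / t) t) ⟩
  t * (n / t) + t * (n / t)   ≡⟨ *-distribʳ-+ (n / t) t t ⟨
  (t + t) * (n / t)           ≡⟨ cong (λ s → (t + s) * (n / t)) (+-identityʳ t) ⟨
  2 * t * (n / t)             ∎
  where open ≤-Reasoning

module _ (em : ExcludedMiddle 0ℓ) {t : ℕ} .{{_ : NonZero t}} (root : Fin t) {T : Graph t}
         (R : RootedOrder T) (k : ℕ) (F : Family) where

  -- Tops count components, so this says that `T` has at least `suc k` components outside `U`;
  -- `suc k` is the exponent of the lower bound.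
  ManyTops : Subset t → Set
  ManyTops U = ∃[ ws ] Unique ws × All (Top R U) ws × suc k ≤ length ws

  Realised : Subset t → ℕ → Set
  Realised U n = Σ (Graph n) λ G → Free F G × Sunflower T G U (n / t)

  -- Placing the components freely in `n / t` petals gives the copies. Both constants depend on `T`
  -- and `k` alone.
  manyCopies : ∀ {U} → ManyTops U → (∀ n → t ≤ n → Realised U n) →
    Bounded ((2 * t) ^ suc k) t (λ n → n ^ suc k) (λ n → exCopies em n T F)
  manyCopies (ws , u , tops , k<ws) realised n t≤n with realised n t≤n
  ... | G , free , sun = begin
    n ^ suc k                         ≤⟨ ^-monoˡ-≤ (suc k) (n≤2t[n/t] n t t≤n) ⟩
    (2 * t * (n / t)) ^ suc k         ≡⟨ ^-distribʳ-* (suc k) (2 * t) (n / t) ⟩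
    (2 * t) ^ suc k * (n / t) ^ suc k ≤⟨ *-monoʳ-≤ ((2 * t) ^ suc k)
      (maxOverFree-≥ em F (copyCount em T) {G} free λ {G′} same →
      ≤-trans (^-monoʳ-≤ (n / t) {{>-nonZero (m≥n⇒m/n>0 t≤n)}} k<ws)
        (sunflower-copies {T = T} {G′} em R (sunflower-map (≗ᴳ⇒embedding {G = G} {G′} same) sun)
          u tops (≤-trans z<s k<ws))) ⟩
    (2 * t) ^ suc k * exCopies em n T F ∎
    where open ≤-Reasoning

  module _ (never : ∀ U → ManyTops U → ∃[ n ] t ≤ n × ¬ Realised U n) where

    threshold : Subset t → ℕ
    threshold U with em {ManyTops U}
    ... | yes many = proj₁ (never U many)
    ... | no _ = 0

    threshold-¬realised : ∀ {U} → ManyTops U → ¬ Realised U (threshold U)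
    threshold-¬realised {U} many with em {ManyTops U}
    ... | yes p = proj₂ (proj₂ (never U p))
    ... | no ¬p = contradiction many ¬p

    -- At least every threshold, so that sunflowers can be pulled back to the order where they are
    -- impossible, and above `t`, as the intersection of kernels requires.
    size : ℕ
    size = suc t + max 0 (map threshold (subsets t))

    threshold≤size : ∀ U → threshold U ≤ size
    threshold≤size U = ≤-trans
      (v≤max⁺ 0 (map threshold (subsets t)) (inj₂ (Any.map ≤-reflexive (∈-map⁺ threshold (∈-subsets U)))))
      (m≤n+m _ (suc t))

    -- Otherwise `m / t` of the petals, covering at most `m` vertices, would realise `U` at its own
    -- threshold `m`.
    fewTops : ∀ {n} {G : Graph n} → size ≤ n → Free F G → ∀ {U} → Sunflower T G U size →
      ∀ {vs} → Unique vs → All (Top R U) vs → length vs < suc k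
    fewTops {n} {G} size≤n free {U} sun {vs} u tops = decidable-stable (length vs <? suc k) λ ≮ →
      let m = threshold U
          (G′ , sun′ , φ , emb) = sunflower-pullback sun (≤-trans (m/n≤m m t) (threshold≤size U))
            (m/n*n≤m m t) (≤-trans (threshold≤size U) size≤n)
      in threshold-¬realised (vs , u , tops , ≮⇒≥ ≮) (G′ , free-pullback F {G = G} {G′ = G′} emb free , sun′)

    private
      proper? : ∀ (U : Subset t) → Dec (Proper U)
      proper? U = Fin.any? λ x → ¬? (x ∈? U)
      kernels : List (Subset t)
      kernels = filter proper? (subsets t)

    -- Distinct embeddings have a proper agreement, so the induction starts from all proper subsets.
    -- The factor `2 ^ k` comes from counting each edge in both orientations.
    fewCopies : ∃[ C ] ∃[ M ] Bounded C M (λ n → exCopies em n T F) (λ n → ex em n F ^ k)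
    fewCopies = factor t size (length kernels) * 2 ^ k , size , λ n size≤n →
      maxOverFree-≤ em F (copyCount em T) λ {G} free → let open ≤-Reasoning in begin
      copyCount em T G                ≤⟨ copyCount-≤ em T G ⟩
      length (embeddings em T G)
        ≤⟨ length-embeddings-≤ em R G root size (m≤m+n (suc t) _) k (fewTops size≤n free)
             (length kernels) {kernels} ≤-refl (proj₂ ∘ ∈-filter⁻ proper? {xs = subsets t})
             (Unique.filter⁺ _ (vecs-unique (Unique.allFin⁺ n) t))
             (proj₂ ∘ ∈-filter⁻ (λ v → em {IsEmbedding T G (Vec.lookup v)}) {xs = vecs (allFin n) t})
             (λ {f} {g} _ _ f≢g → ∈-filter⁺ proper? (∈-subsets _) (agreement-proper f g f≢g)) ⟩
      K * length (arcs G) ^ k         ≤⟨ *-monoʳ-≤ K (^-monoˡ-≤ k (≤-trans (length-arcs G)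
             (*-monoʳ-≤ 2 (maxOverFree-≥ em F edgeCount {G} free (λ {G′} → edgeCount-mono {G = G} {G′}))))) ⟩
      K * (2 * ex em n F) ^ k         ≡⟨ cong (K *_) (^-distribʳ-* k 2 (ex em n F)) ⟩
      K * (2 ^ k * ex em n F ^ k)     ≡⟨ *-assoc K (2 ^ k) _ ⟨
      K * 2 ^ k * ex em n F ^ k       ∎
      where
      K = factor t size (length kernels)

theorem2p5 : (em : ExcludedMiddle 0ℓ) →
    ∀ {t} (T : Graph t) → IsTree T → ¬ (T ≅ K₁) →
    ∀ (k : ℕ) → 1 ≤ k →
    ∃[ c ] ∃[ N ] (0 < c × (∀ (F : Family) →
    Bounded c N (λ n → n ^ k) (λ n → exCopies em n T F)
    ⊎ (∃[ C ] ∃[ M ] Bounded C M (λ n → exCopies em n T F) (λ n → ex em n F ^ (k ∸ 1)))))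
theorem2p5 em {zero} T ((() , _) , _)
theorem2p5 em {t@(suc _)} T tree T≇K₁ (suc k) _ = (2 * t) ^ suc k , t , m^n>0 (2 * t) (suc k) , dichotomy
  where
  R = rootedOrder {T = T} tree T≇K₁
  dichotomy : ∀ F → Bounded ((2 * t) ^ suc k) t (λ n → n ^ suc k) (λ n → exCopies em n T F)
    ⊎ (∃[ C ] ∃[ M ] Bounded C M (λ n → exCopies em n T F) (λ n → ex em n F ^ k))
  -- The cases are whether one kernel with many components is realised at every order from `t` on,
  -- or each such kernel fails at some order.
  dichotomy F with em {∃[ U ] ManyTops em zero R k F U × (∀ n → t ≤ n → Realised em zero R k F U n)}
  ... | yes (U , many , realised) = inj₁ (manyCopies em zero R k F many realised)
  ... | no none = inj₂ (fewCopies em zero R k F λ U many → decidable-stable em λ never →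
    none (U , many , λ n t≤n → decidable-stable em λ ¬r → never (n , t≤n , ¬r)))
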